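{- Let $k$ and $s$ be positive integers with $s\in\{\lceil k/2\rceil,\ldots,k-2\}$, and for $n\ge1$ let $b_n^{(k,s)}$ be the number of vertices of the polytope $P_{n,k,s}$. Then $$\lim_{n\to\infty}\frac1n\ln b_n^{(k,s)}=\ln\left(\frac{2(k-s)(k-s-1)}{k-\sqrt{k^2-4(k-s)(k-s-1)}}\right).$$
   Context: For positive integers $n,k,s$ let $K=s(n-1)+k$ and let $e_0,\ldots,e_{K-1}$ be the standard basis of $\mathbb{R}^{K}$. For $0\le i\le n-1$ let $\lambda_i=\{si,si+1,\ldots,si+k-1\}$ and $\Delta_{\lambda_i}=\operatorname{conv}\{e_j: j\in\lambda_i\}$. Then $P_{n,k,s}=\sum_{i=0}^{n-1}\Delta_{\lambda_i}$ (Minkowski sum). -}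

module Defs where

open import Data.Bool.Base using (if_then_else_)
open import Data.Fin.Base using (Fin; toℕ)
import Data.Fin.Properties as Fin
open import Data.Integer.Base using (+_)
open import Data.Nat.Base as ℕ using (ℕ; zero; suc; NonZero)
import Data.Nat.Properties as ℕ
open import Data.Product.Base using (Σ; ∃; ∃-syntax; _×_; _,_; proj₁; proj₂)
open import Data.Rational.Base as ℚ using (ℚ; 0ℚ; 1ℚ)
import Data.Rational.Properties as ℚ
open import Data.Rational.Solver using (module +-*-Solver)
open import Data.Sum.Base using (_⊎_)
open import Data.Vec.Functional using (Vector; foldr)
open import Function.Definitions using (Bijective)
open import Level using (0ℓ)
open import Relation.Binary.PropositionalEquality
  using (_≡_; refl; sym; cong; subst; module ≡-Reasoning)
open import Relation.Nullary.Decidable.Core using (does)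
open import Relation.Nullary.Negation.Core using (¬_)
open import Relation.Unary using (Pred; _∈_)

------------------------------------------------------------------------
-- Real numbers: Cauchy sequences of rationals, considered up to _≈_

IsCauchy : (ℕ → ℚ) → Set
IsCauchy x = ∀ ε → 0ℚ ℚ.< ε →
  ∃[ N ] ∀ m n → N ℕ.≤ m → N ℕ.≤ n → ℚ.∣ x m ℚ.- x n ∣ ℚ.< ε

record ℝ : Set where
  constructor mkℝ
  field
    seq    : ℕ → ℚ
    cauchy : IsCauchy seq

open ℝ public

infix 4 _≈_ _<_ _≤_

_≈_ : ℝ → ℝ → Set
x ≈ y = ∀ ε → 0ℚ ℚ.< ε →
  ∃[ N ] ∀ n → N ℕ.≤ n → ℚ.∣ seq x n ℚ.- seq y n ∣ ℚ.< ε

_<_ : ℝ → ℝ → Set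
x < y = ∃[ ε ] 0ℚ ℚ.< ε ×
  ∃[ N ] (∀ n → N ℕ.≤ n → seq x n ℚ.+ ε ℚ.< seq y n)

_≤_ : ℝ → ℝ → Set
x ≤ y = ¬ (y < x)

fromℚ : ℚ → ℝ
fromℚ q = mkℝ (λ _ → q) λ ε 0<ε → 0 , λ _ _ _ _ →
  subst (λ d → ℚ.∣ d ∣ ℚ.< ε) (sym (ℚ.+-inverseʳ q)) 0<ε

fromℕ : ℕ → ℝ
fromℕ n = fromℚ (+ n ℚ./ 1)

0ℝ 1ℝ : ℝ
0ℝ = fromℚ 0ℚ
1ℝ = fromℚ 1ℚ

private
  open +-*-Solver using (solve; _:=_; _:+_; _:-_; _:*_)

  split : ∀ a b → a ≡ (a ℚ.- b) ℚ.+ b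
  split = solve 2 (λ a b → a := (a :- b) :+ b) refl

  +-split : ∀ a b c d →
    (a ℚ.+ b) ℚ.- (c ℚ.+ d) ≡ (a ℚ.- c) ℚ.+ (b ℚ.- d)
  +-split = solve 4 (λ a b c d →
    (a :+ b) :- (c :+ d) := (a :- c) :+ (b :- d)) refl

  *-split : ∀ a b c d →
    a ℚ.* b ℚ.- c ℚ.* d ≡ a ℚ.* (b ℚ.- d) ℚ.+ d ℚ.* (a ℚ.- c)
  *-split = solve 4 (λ a b c d →
    a :* b :- c :* d := a :* (b :- d) :+ d :* (a :- c)) refl

  ⊔-boundˡ : ∀ M N m → M ℕ.⊔ N ℕ.≤ m → M ℕ.≤ m
  ⊔-boundˡ M N m = ℕ.≤-trans (ℕ.m≤m⊔n M N)

  ⊔-boundʳ : ∀ M N m → M ℕ.⊔ N ℕ.≤ m → N ℕ.≤ m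
  ⊔-boundʳ M N m = ℕ.≤-trans (ℕ.m≤n⊔m M N)

  halve : ∀ ε → 0ℚ ℚ.< ε → 0ℚ ℚ.< ℚ.½ ℚ.* ε
  halve ε 0<ε = ℚ.*-monoʳ-<-pos ℚ.½ 0<ε

  halves : ∀ ε → ℚ.½ ℚ.* ε ℚ.+ ℚ.½ ℚ.* ε ≡ ε
  halves ε = begin
    ℚ.½ ℚ.* ε ℚ.+ ℚ.½ ℚ.* ε ≡⟨ ℚ.*-distribʳ-+ ε ℚ.½ ℚ.½ ⟨
    1ℚ ℚ.* ε                ≡⟨ ℚ.*-identityˡ ε ⟩
    ε                       ∎
    where open ≡-Reasoning

  share : ∀ X Y ε → 0ℚ ℚ.< X → 0ℚ ℚ.< Y → 0ℚ ℚ.< ε →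
    ∃[ δ ] 0ℚ ℚ.< δ × X ℚ.* δ ℚ.+ Y ℚ.* δ ≡ ε
  share X Y ε 0<X 0<Y 0<ε = go (X ℚ.+ Y) refl (ℚ.+-mono-< 0<X 0<Y)
    where
    open ≡-Reasoning
    go : ∀ B → X ℚ.+ Y ≡ B → 0ℚ ℚ.< B →
         ∃[ δ ] 0ℚ ℚ.< δ × X ℚ.* δ ℚ.+ Y ℚ.* δ ≡ ε
    go B X+Y≡B 0<B = δ , 0<δ , (begin
      X ℚ.* δ ℚ.+ Y ℚ.* δ  ≡⟨ ℚ.*-distribʳ-+ δ X Y ⟨
      (X ℚ.+ Y) ℚ.* δ      ≡⟨ cong (ℚ._* δ) X+Y≡B ⟩
      B ℚ.* δ              ≡⟨ ℚ.*-assoc B (ℚ.1/ B) ε ⟨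
      B ℚ.* ℚ.1/ B ℚ.* ε   ≡⟨ cong (ℚ._* ε) (ℚ.*-inverseʳ B) ⟩
      1ℚ ℚ.* ε             ≡⟨ ℚ.*-identityˡ ε ⟩
      ε                    ∎)
      where
      instance
        B-positive : ℚ.Positive B
        B-positive = ℚ.positive 0<B
        B-nonZero : ℚ.NonZero B
        B-nonZero = ℚ.pos⇒nonZero B
      δ = ℚ.1/ B ℚ.* ε
      0<δ : 0ℚ ℚ.< δ
      0<δ = ℚ.positive⁻¹ δ
        {{ℚ.pos*pos⇒pos (ℚ.1/ B) {{ℚ.1/pos⇒pos B}} ε {{ℚ.positive 0<ε}}}}

  ∣∣-*-< : ∀ p q {C δ} → ℚ.∣ p ∣ ℚ.< C → ℚ.∣ q ∣ ℚ.< δ →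
    ℚ.∣ p ℚ.* q ∣ ℚ.< C ℚ.* δ
  ∣∣-*-< p q {C} {δ} p<C q<δ = begin-strict
    ℚ.∣ p ℚ.* q ∣       ≡⟨ ℚ.∣p*q∣≡∣p∣*∣q∣ p q ⟩
    ℚ.∣ p ∣ ℚ.* ℚ.∣ q ∣ ≤⟨ ℚ.*-monoʳ-≤-nonNeg ℚ.∣ q ∣
                             {{ℚ.nonNegative (ℚ.0≤∣p∣ q)}} (ℚ.<⇒≤ p<C) ⟩
    C ℚ.* ℚ.∣ q ∣       <⟨ ℚ.*-monoʳ-<-pos C
                             {{ℚ.positive (ℚ.≤-<-trans (ℚ.0≤∣p∣ p) p<C)}} q<δ ⟩
    C ℚ.* δ             ∎
    where open ℚ.≤-Reasoning

  product-close : ∀ a b c d {X Y δ ε} → X ℚ.* δ ℚ.+ Y ℚ.* δ ≡ ε →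
    ℚ.∣ a ∣ ℚ.< X → ℚ.∣ d ∣ ℚ.< Y →
    ℚ.∣ b ℚ.- d ∣ ℚ.< δ → ℚ.∣ a ℚ.- c ∣ ℚ.< δ →
    ℚ.∣ a ℚ.* b ℚ.- c ℚ.* d ∣ ℚ.< ε
  product-close a b c d {X} {Y} {δ} {ε} Xδ+Yδ≡ε a<X d<Y b-d<δ a-c<δ = begin-strict
    ℚ.∣ a ℚ.* b ℚ.- c ℚ.* d ∣
      ≡⟨ cong ℚ.∣_∣ (*-split a b c d) ⟩
    ℚ.∣ a ℚ.* (b ℚ.- d) ℚ.+ d ℚ.* (a ℚ.- c) ∣
      ≤⟨ ℚ.∣p+q∣≤∣p∣+∣q∣ (a ℚ.* (b ℚ.- d)) (d ℚ.* (a ℚ.- c)) ⟩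
    ℚ.∣ a ℚ.* (b ℚ.- d) ∣ ℚ.+ ℚ.∣ d ℚ.* (a ℚ.- c) ∣
      <⟨ ℚ.+-mono-< (∣∣-*-< a (b ℚ.- d) a<X b-d<δ) (∣∣-*-< d (a ℚ.- c) d<Y a-c<δ) ⟩
    X ℚ.* δ ℚ.+ Y ℚ.* δ
      ≡⟨ Xδ+Yδ≡ε ⟩
    ε ∎
    where open ℚ.≤-Reasoning

  eventuallyBounded : ∀ {x} → IsCauchy x →
    ∃[ B ] 0ℚ ℚ.< B × ∃[ N ] (∀ n → N ℕ.≤ n → ℚ.∣ x n ∣ ℚ.< B)
  eventuallyBounded {x} cx with N , close ← cx 1ℚ (ℚ.positive⁻¹ 1ℚ) =
    1ℚ ℚ.+ ℚ.∣ x N ∣ ,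
    ℚ.+-mono-<-≤ (ℚ.positive⁻¹ 1ℚ) (ℚ.0≤∣p∣ (x N)) ,
    N , λ n N≤n → begin-strict
      ℚ.∣ x n ∣
        ≡⟨ cong ℚ.∣_∣ (split (x n) (x N)) ⟩
      ℚ.∣ (x n ℚ.- x N) ℚ.+ x N ∣
        ≤⟨ ℚ.∣p+q∣≤∣p∣+∣q∣ (x n ℚ.- x N) (x N) ⟩
      ℚ.∣ x n ℚ.- x N ∣ ℚ.+ ℚ.∣ x N ∣
        <⟨ ℚ.+-monoˡ-< ℚ.∣ x N ∣ (close n N N≤n ℕ.≤-refl) ⟩
      1ℚ ℚ.+ ℚ.∣ x N ∣ ∎
    where
    open ℚ.≤-Reasoning

infixl 6 _+_ _-_
infixl 7 _*_
infix  8 -_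
infixr 8 _^_

_+_ : ℝ → ℝ → ℝ
x + y = mkℝ (λ n → seq x n ℚ.+ seq y n) λ ε 0<ε →
  let N₁ , p = cauchy x (ℚ.½ ℚ.* ε) (halve ε 0<ε)
      N₂ , q = cauchy y (ℚ.½ ℚ.* ε) (halve ε 0<ε)
  in N₁ ℕ.⊔ N₂ , λ m n N≤m N≤n →
    let a = seq x m; b = seq y m; c = seq x n; d = seq y n in begin-strict
    ℚ.∣ (a ℚ.+ b) ℚ.- (c ℚ.+ d) ∣
      ≡⟨ cong ℚ.∣_∣ (+-split a b c d) ⟩
    ℚ.∣ (a ℚ.- c) ℚ.+ (b ℚ.- d) ∣
      ≤⟨ ℚ.∣p+q∣≤∣p∣+∣q∣ (a ℚ.- c) (b ℚ.- d) ⟩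
    ℚ.∣ a ℚ.- c ∣ ℚ.+ ℚ.∣ b ℚ.- d ∣
      <⟨ ℚ.+-mono-< (p m n (⊔-boundˡ N₁ N₂ m N≤m) (⊔-boundˡ N₁ N₂ n N≤n))
                    (q m n (⊔-boundʳ N₁ N₂ m N≤m) (⊔-boundʳ N₁ N₂ n N≤n)) ⟩
    ℚ.½ ℚ.* ε ℚ.+ ℚ.½ ℚ.* ε
      ≡⟨ halves ε ⟩
    ε ∎
  where
  open ℚ.≤-Reasoning

-_ : ℝ → ℝ
- x = mkℝ (λ n → ℚ.- seq x n) λ ε 0<ε →
  let N , p = cauchy x ε 0<ε
  in N , λ m n N≤m N≤n → let a = seq x m; c = seq x n in begin-strict
    ℚ.∣ (ℚ.- a) ℚ.- (ℚ.- c) ∣ ≡⟨ cong ℚ.∣_∣ (ℚ.neg-distrib-+ a (ℚ.- c)) ⟨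
    ℚ.∣ ℚ.- (a ℚ.- c) ∣       ≡⟨ ℚ.∣-p∣≡∣p∣ (a ℚ.- c) ⟩
    ℚ.∣ a ℚ.- c ∣             <⟨ p m n N≤m N≤n ⟩
    ε ∎
  where open ℚ.≤-Reasoning

_-_ : ℝ → ℝ → ℝ
x - y = x + - y

_*_ : ℝ → ℝ → ℝ
x * y = mkℝ (λ n → seq x n ℚ.* seq y n) λ ε 0<ε →
  let X , 0<X , N₁ , ∣x∣<X = eventuallyBounded {seq x} (cauchy x)
      Y , 0<Y , N₂ , ∣y∣<Y = eventuallyBounded {seq y} (cauchy y)
      δ , 0<δ , Xδ+Yδ≡ε = share X Y ε 0<X 0<Y 0<ε
      N₃ , p = cauchy x δ 0<δ
      N₄ , q = cauchy y δ 0<δ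
      N = (N₁ ℕ.⊔ N₂) ℕ.⊔ (N₃ ℕ.⊔ N₄)
      in₁₂ = ⊔-boundˡ (N₁ ℕ.⊔ N₂) (N₃ ℕ.⊔ N₄)
      in₃₄ = ⊔-boundʳ (N₁ ℕ.⊔ N₂) (N₃ ℕ.⊔ N₄)
  in N , λ m n N≤m N≤n → product-close (seq x m) (seq y m) (seq x n) (seq y n) Xδ+Yδ≡ε
    (∣x∣<X m (⊔-boundˡ N₁ N₂ m (in₁₂ m N≤m)))
    (∣y∣<Y n (⊔-boundʳ N₁ N₂ n (in₁₂ n N≤n)))
    (q m n (⊔-boundʳ N₃ N₄ m (in₃₄ m N≤m)) (⊔-boundʳ N₃ N₄ n (in₃₄ n N≤n)))
    (p m n (⊔-boundˡ N₃ N₄ m (in₃₄ m N≤m)) (⊔-boundˡ N₃ N₄ n (in₃₄ n N≤n)))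

_^_ : ℝ → ℕ → ℝ
x ^ zero  = 1ℝ
x ^ suc n = x * x ^ n

1/ℕ : (n : ℕ) → .{{NonZero n}} → ℝ
1/ℕ n = fromℚ (+ 1 ℚ./ n)

∑ : ∀ {n} → Vector ℝ n → ℝ
∑ = foldr _+_ 0ℝ

------------------------------------------------------------------------
-- Limits and the partial operations √, / and ln.  Each partial operation
-- is given by its graph.

infix 4 _⟶_ _≈√_ _≈_÷_ _≈exp_ _≈ln_

-- Sequences are indexed by the positive integers.
_⟶_ : ((n : ℕ) → .{{NonZero n}} → ℝ) → ℝ → Set
a ⟶ ℓ = ∀ ε → 0ℝ < ε →
  ∃[ N ] ∀ n .{{_ : NonZero n}} → N ℕ.≤ n → (a n - ℓ < ε) × (ℓ - a n < ε)

_≈√_ : ℝ → ℝ → Set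
r ≈√ x = 0ℝ ≤ r × r * r ≈ x

_≈_÷_ : ℝ → ℝ → ℝ → Set
q ≈ x ÷ y = (y < 0ℝ ⊎ 0ℝ < y) × q * y ≈ x

1/_! : ℕ → ℝ
1/ j ! = 1/ℕ (j ℕ.!) {{j ℕ.!≢0}}

-- y = exp x, as the sum of the exponential series.
_≈exp_ : ℝ → ℝ → Set
y ≈exp x = (λ n → ∑ {n} λ j → x ^ toℕ j * 1/ toℕ j !) ⟶ y

_≈ln_ : ℝ → ℝ → Set
x ≈ln y = y ≈exp x

------------------------------------------------------------------------
-- Convex geometry in ℝᴷ

Point : ℕ → Set
Point = Vector ℝ

infix  4 _≋_
infixl 7 _·_

_≋_ : ∀ {K} → Point K → Point K → Set
x ≋ y = ∀ j → x j ≈ y j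

_·_ : ∀ {K} → Point K → Point K → ℝ
c · x = ∑ λ j → c j * x j

basis : ∀ {K} → Fin K → Point K
basis i j = if does (i Fin.≟ j) then 1ℝ else 0ℝ

conv : ∀ {K} → Pred (Point K) 0ℓ → Pred (Point K) 0ℓ
conv {K} S x =
  ∃[ m ] Σ (Fin m → Point K) λ p → Σ (Fin m → ℝ) λ t →
    (∀ i → p i ∈ S) × (∀ i → 0ℝ ≤ t i) × ∑ t ≈ 1ℝ ×
    x ≋ (λ j → ∑ λ i → t i * p i j)

minkowskiSum : ∀ {K n} → (Fin n → Pred (Point K) 0ℓ) → Pred (Point K) 0ℓ
minkowskiSum {K} {n} Q x =
  Σ (Fin n → Point K) λ y → (∀ i → y i ∈ Q i) × x ≋ (λ j → ∑ λ i → y i j)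

-- {v} is a face of P: some linear functional is maximised over P
-- exactly at v.
IsVertex : ∀ {K} → Pred (Point K) 0ℓ → Pred (Point K) 0ℓ
IsVertex {K} P v = v ∈ P × Σ (Point K) λ c →
  ∀ x → x ∈ P → (c · x ≤ c · v) × (c · x ≈ c · v → x ≋ v)

HasVertexCount : ∀ {K} → Pred (Point K) 0ℓ → ℕ → Set
HasVertexCount P b = Σ (Fin b → ∃ (IsVertex P))
  (Bijective _≡_ λ v w → proj₁ v ≋ proj₁ w)

------------------------------------------------------------------------
-- The polytopes P_{n,k,s} ⊆ ℝᴷ, K = s(n-1)+k

dim : (n k s : ℕ) → ℕ
dim n k s = s ℕ.* (n ℕ.∸ 1) ℕ.+ k

block : (n k s : ℕ) → Fin n → Pred (Fin (dim n k s)) 0ℓ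
block n k s i j = s ℕ.* toℕ i ℕ.≤ toℕ j × toℕ j ℕ.< s ℕ.* toℕ i ℕ.+ k

Δ : ∀ {K} → Pred (Fin K) 0ℓ → Pred (Point K) 0ℓ
Δ Λ = conv λ p → ∃[ j ] j ∈ Λ × p ≋ basis j

P : (n k s : ℕ) → Pred (Point (dim n k s)) 0ℓ
P n k s = minkowskiSum λ i → Δ (block n k s i)

{-# OPTIONS --safe #-}

module Submission where

open import Algebra.Bundles using (CommutativeRing)
import Algebra.Properties.Semiring.Sum
import Algebra.Solver.Ring
open import Algebra.Solver.Ring.AlmostCommutativeRing
  using (_-Raw-AlmostCommutative⟶_; Induced-equivalence; fromCommutativeRing)
open import Algebra.Structures using (IsCommutativeRing)
open import Data.Bool.Base using (if_then_else_)
open import Data.Empty using (⊥-elim)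
open import Data.Fin.Base as Fin using (Fin; zero; suc; toℕ; fromℕ<)
import Data.Fin.Properties as Fin
open import Data.Integer.Base as ℤ using (ℤ; +_)
import Data.Integer.Properties as ℤ
open import Data.List.Base as List using (List; []; _∷_)
open import Data.List.Membership.Propositional using (_∈_)
open import Data.List.Membership.Propositional.Properties using (∈-lookup)
open import Data.List.Relation.Unary.All as All using ([]; _∷_)
open import Data.List.Relation.Unary.AllPairs using ([]; _∷_)
open import Data.List.Relation.Unary.Any using (index)
open import Data.List.Relation.Unary.Any.Properties using (lookup-index)
open import Data.List.Relation.Unary.Unique.Propositional using (Unique)
open import Data.Maybe.Base using (just; nothing)
open import Data.Nat.Base as ℕ using (ℕ; zero; suc; NonZero; ⌈_/2⌉; z≤n; s≤s; _!)
import Data.Nat.Properties as ℕ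
open import Data.Product.Base using (Σ; ∃; ∃-syntax; _×_; _,_; proj₁; proj₂; swap)
open import Data.Rational.Base as ℚ using (ℚ; 0ℚ; 1ℚ)
import Data.Rational.Properties as ℚ
open import Data.Rational.Unnormalised.Base as ℚᵘ using (mkℚᵘ; *≡*; *≤*)
import Data.Rational.Unnormalised.Properties as ℚᵘ
open import Data.Sum.Base using (_⊎_; inj₁; inj₂)
open import Data.Vec.Base as Vec using (Vec; []; _∷_; lookup; tabulate)
import Data.Vec.Properties as Vec
open import Data.Vec.Functional using (Vector)
open import Data.Vec.Relation.Unary.Linked using (Linked; []; [-]; _∷_)
open import Function.Base using (_∘_; id)
open import Function.Definitions using (Bijective)
open import Level using (0ℓ)
open import Relation.Binary.Definitions using (WeaklyDecidable; tri<; tri≈; tri>)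
open import Relation.Binary.PropositionalEquality as ≡ using (_≡_; _≢_)
import Relation.Binary.Reasoning.Setoid
open import Relation.Binary.Structures using (IsEquivalence)
open import Relation.Nullary using (¬_; yes; no; does)
open import Relation.Nullary.Decidable using (decidable-stable)
open import Relation.Nullary.Decidable.Core using (¬¬-excluded-middle)
open import Relation.Unary using (Pred)
import Defs as D

-- Since k ≤ 2s, only consecutive blocks meet.  A vertex of P maximises a linear
-- functional; recording the maximising coordinate of each block gives a word,
-- and the words that arise are those in which two consecutive letters lying in
-- the common part of their blocks denote the same coordinate.  With d = k − s,
-- counting them gives b(n+2) = k b(n+1) − d(d−1) b(n), b(0) = 1 and b(1) = k, so
-- Lⁿ ≤ b(n) ≤ k Lⁿ for the larger root L = (k + r)/2 of x² = kx − d(d−1).  The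
-- inequality exp x (1 + (y − x)) ≤ exp y for x ≤ y, which follows from the
-- functional equation, then yields 0 ≤ ln b(n) − n ln L ≤ k.
--
-- Weak inequalities and equations between reals, as well as the value of b(n),
-- are stable under double negation, so classical reasoning is available for all
-- of this although the reals are constructive.

-- The condition on consecutive letters comes from competition: a coordinate of the overlap is a
-- candidate in both blocks, so two chosen letters in the overlap must be one coordinate once ties
-- are broken alike. Conversely, any word obeying it is realised by explicit natural weights.
--
-- The recurrence has order two because one statistic of a word suffices: whether its first letter
-- lies in the overlap with the block before. Such a letter admits s + 1 predecessors instead of k,
-- and of the predecessors of any word exactly d are again of this kind.
--
-- The stated limit is ln L before rationalising: k² - r² = 4d(d - 1) turns 2d(d - 1)/(k - r) into
-- (k + r)/2. The constant k of the upper bound rests on r ≥ 1, a consequence of d ≤ s and 2 ≤ d.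
--
-- Neither continuity nor monotonicity of ln is developed; logarithms are compared through the
-- exponential series alone. Geometry and analysis run over an abstract ordered field, so Cauchy
-- sequences occur only where its axioms are verified.

-- Integers inside the rationals, and ring solving with integer coefficients.

module Cast where

  private
    toℚᵘ-/1 : ∀ i → ℚ.toℚᵘ (i ℚ./ 1) ℚᵘ.≃ mkℚᵘ i 0
    toℚᵘ-/1 i = ℚ.toℚᵘ-fromℚᵘ (mkℚᵘ i 0)

  /1-+ : ∀ i j → (i ℤ.+ j) ℚ./ 1 ≡ i ℚ./ 1 ℚ.+ j ℚ./ 1
  /1-+ i j = ℚ.toℚᵘ-injective (ℚᵘ.≃-trans (toℚᵘ-/1 (i ℤ.+ j))
    (ℚᵘ.≃-sym (ℚᵘ.≃-trans (ℚ.toℚᵘ-homo-+ (i ℚ./ 1) (j ℚ./ 1))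
      (ℚᵘ.≃-trans (ℚᵘ.+-cong (toℚᵘ-/1 i) (toℚᵘ-/1 j)) (*≡*
        (≡.cong (ℤ._* + 1) (≡.cong₂ ℤ._+_ (ℤ.*-identityʳ i) (ℤ.*-identityʳ j))))))))

  /1-* : ∀ i j → (i ℤ.* j) ℚ./ 1 ≡ (i ℚ./ 1) ℚ.* (j ℚ./ 1)
  /1-* i j = ℚ.toℚᵘ-injective (ℚᵘ.≃-trans (toℚᵘ-/1 (i ℤ.* j))
    (ℚᵘ.≃-sym (ℚᵘ.≃-trans (ℚ.toℚᵘ-homo-* (i ℚ./ 1) (j ℚ./ 1))
      (ℚᵘ.≃-trans (ℚᵘ.*-cong (toℚᵘ-/1 i) (toℚᵘ-/1 j)) (*≡* ≡.refl)))))

  /1-neg : ∀ i → (ℤ.- i) ℚ./ 1 ≡ ℚ.- (i ℚ./ 1)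
  /1-neg i = ℚ.toℚᵘ-injective (ℚᵘ.≃-trans (toℚᵘ-/1 (ℤ.- i))
    (ℚᵘ.≃-sym (ℚᵘ.≃-trans (ℚ.toℚᵘ-homo‿- (i ℚ./ 1)) (ℚᵘ.-‿cong (toℚᵘ-/1 i)))))

  /1-inverse : ∀ n .{{_ : NonZero n}} → (+ n ℚ./ 1) ℚ.* (+ 1 ℚ./ n) ≡ 1ℚ
  /1-inverse n@(ℕ.suc m) = ℚ.toℚᵘ-injective (ℚᵘ.≃-trans (ℚ.toℚᵘ-homo-* (+ n ℚ./ 1) (+ 1 ℚ./ n))
    (ℚᵘ.≃-trans (ℚᵘ.*-cong (toℚᵘ-/1 (+ n)) (ℚ.toℚᵘ-fromℚᵘ (mkℚᵘ (+ 1) m)))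
        (*≡* (≡.trans (ℤ.*-identityʳ (+ n ℤ.* + 1)) (≡.trans (ℤ.*-identityʳ (+ n))
            (≡.sym (≡.trans (ℤ.*-identityˡ (+ (1 ℕ.* n))) (≡.cong +_ (ℕ.*-identityˡ n)))))))))

  -- The denominator is at least 1. This is the source of the archimedean property.
  ≤∣↥∣ : ∀ q → q ℚ.≤ + ℤ.∣ ℚ.↥ q ∣ ℚ./ 1
  ≤∣↥∣ q@record{} = ℚ.toℚᵘ-cancel-≤ (ℚᵘ.≤-trans (*≤* (go (ℚ.↥ q) (ℚ.denominator-1 q)))
     (ℚᵘ.≤-reflexive (ℚᵘ.≃-sym (toℚᵘ-/1 (+ ℤ.∣ ℚ.↥ q ∣)))))
    where
    go : ∀ i d → i ℤ.* + 1 ℤ.≤ + ℤ.∣ i ∣ ℤ.* + (ℕ.suc d)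
    go (+ n) d = ≡.subst₂ ℤ._≤_ (≡.sym (ℤ.*-identityʳ (+ n))) (ℤ.pos-* n (ℕ.suc d))
        (ℤ.+≤+ (ℕ.m≤m*n n (ℕ.suc d)))
    go ℤ.-[1+ n ] d = ≡.subst₂ ℤ._≤_ (≡.sym (ℤ.*-identityʳ ℤ.-[1+ n ]))
        (ℤ.pos-* (ℕ.suc n) (ℕ.suc d)) ℤ.-≤+

  -- Normal forms are compared through their coefficients; taking these in ℤ supplies decidable
  -- equality where `R` has none.
  module IntegerSolver (R : CommutativeRing 0ℓ 0ℓ)
    (morphism : ℤ.+-*-rawRing -Raw-AlmostCommutative⟶ fromCommutativeRing R) where

    private
      coeff≟ : WeaklyDecidable (Induced-equivalence morphism)
      coeff≟ i j with i ℤ.≟ j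
      ... | yes ≡.refl = just (CommutativeRing.refl R)
      ... | no _       = nothing

    open Algebra.Solver.Ring ℤ.+-*-rawRing (fromCommutativeRing R) morphism coeff≟ public

  /1-morphism : ℤ.+-*-rawRing -Raw-AlmostCommutative⟶ fromCommutativeRing ℚ.+-*-commutativeRing
  /1-morphism = record
    { ⟦_⟧ = ℚ._/ 1
    ; +-homo = /1-+
    ; *-homo = /1-*
    ; -‿homo = /1-neg
    ; 0-homo = ≡.refl
    ; 1-homo = ≡.refl
    }

  module ℚ-Solver = IntegerSolver ℚ.+-*-commutativeRing /1-morphism

record OrderedField : Set₁ where
  infix  4 _≈_ _<_
  infixl 6 _+_
  infixl 7 _*_
  infix  8 -_
  field
    Carrier : Set
    _≈_ _<_ : Carrier → Carrier → Set
    _+_ _*_ : Carrier → Carrier → Carrier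
    -_      : Carrier → Carrier
    -- `int` and `recip` are data rather than derived, so that for the reals they are
    -- `fromℚ (i / 1)` and `1/ℕ` by definition. Zero and one are values of `int`, which makes it
    -- preserve them by reflexivity.
    int     : ℤ → Carrier
    recip   : (n : ℕ) → .{{NonZero n}} → Carrier
    isCommutativeRing : IsCommutativeRing _≈_ _+_ _*_ -_ (int (+ 0)) (int (+ 1))
    int-+ : ∀ i j → int (i ℤ.+ j) ≈ int i + int j
    int-* : ∀ i j → int (i ℤ.* j) ≈ int i * int j
    int-neg : ∀ i → int (ℤ.- i) ≈ - int i
    recip-inverse : ∀ n .{{_ : NonZero n}} → int (+ n) * recip n ≈ int (+ 1)
    recip-pos : ∀ n .{{_ : NonZero n}} → int (+ 0) < recip n
    <-irrefl : ∀ {x y} → x ≈ y → ¬ x < y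
    <-trans : ∀ {x y z} → x < y → y < z → x < z
    -- Cotransitivity and tightness take the place of trichotomy, which is not decidable for Cauchy
    -- reals.
    <-cotrans : ∀ {x y} → x < y → ∀ z → x < z ⊎ z < y
    tight : ∀ {x y} → ¬ x < y → ¬ y < x → x ≈ y
    0<1 : int (+ 0) < int (+ 1)
    +-monoˡ-< : ∀ z {x y} → x < y → x + z < y + z
    *-pos : ∀ {x y} → int (+ 0) < x → int (+ 0) < y → int (+ 0) < x * y
    archimedean : ∀ x → ∃[ n ] x < int (+ n)
    archimedean′ : ∀ {x} → int (+ 0) < x → ∃[ n ] int (+ 1) < int (+ n) * x

-- The Cauchy reals as an ordered field.

module RealField where

  private
    open Cast.ℚ-Solver using (solve; con; _:=_; _:+_; _:-_; _:*_; :-_)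

    Eventually : (ℕ → Set) → Set
    Eventually P = ∃[ N ] ∀ n → N ℕ.≤ n → P n

    zipE : {P Q R : ℕ → Set} → (∀ n → P n → Q n → R n) →
           Eventually P → Eventually Q → Eventually R
    zipE f (M , p) (N , q) = M ℕ.⊔ N , λ n le →
      f n (p n (ℕ.≤-trans (ℕ.m≤m⊔n M N) le)) (q n (ℕ.≤-trans (ℕ.m≤n⊔m M N) le))

    mapE : {P Q : ℕ → Set} → (∀ n → P n → Q n) → Eventually P → Eventually Q
    mapE f (M , p) = M , λ n le → f n (p n le)

    alwaysE : {P : ℕ → Set} → (∀ n → P n) → Eventually P
    alwaysE p = 0 , λ n _ → p n

    <⇒0< : ∀ {p q} → p ℚ.< q → 0ℚ ℚ.< q ℚ.- p
    <⇒0< {p} {q} p<q = ≡.subst (ℚ._< q ℚ.- p) (ℚ.+-inverseʳ p) (ℚ.+-monoˡ-< (ℚ.- p) p<q)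

    0<⇒< : ∀ {p q} → 0ℚ ℚ.< q ℚ.- p → p ℚ.< q
    0<⇒< {p} {q} h = ≡.subst₂ ℚ._<_ (ℚ.+-identityˡ p)
      (solve 2 (λ p q → (q :- p) :+ p := q) ≡.refl p q) (ℚ.+-monoˡ-< p h)

    ≤⇒0≤ : ∀ {p q} → p ℚ.≤ q → 0ℚ ℚ.≤ q ℚ.- p
    ≤⇒0≤ {p} {q} p≤q = ≡.subst (ℚ._≤ q ℚ.- p) (ℚ.+-inverseʳ p) (ℚ.+-monoˡ-≤ (ℚ.- p) p≤q)

    ∣∣<⇒< : ∀ {a ε} → ℚ.∣ a ∣ ℚ.< ε → a ℚ.< ε × ℚ.- a ℚ.< ε
    ∣∣<⇒< {a} {ε} h with ℚ.∣p∣≡p∨∣p∣≡-p a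
    ... | inj₁ e = ≡.subst (ℚ._< ε) e h , ℚ.≤-<-trans (ℚ.≤-trans (ℚ.neg-antimono-≤ 0≤a) 0≤a) a<ε
      where
      0≤a = ℚ.∣p∣≡p⇒0≤p e
      a<ε = ≡.subst (ℚ._< ε) e h
    ... | inj₂ e = ℚ.≤-<-trans (ℚ.≤-trans a≤0 (ℚ.0≤∣p∣ a)) h , ≡.subst (ℚ._< ε) e h
      where
      a≤0 : a ℚ.≤ 0ℚ
      a≤0 = ≡.subst (ℚ._≤ 0ℚ) (solve 1 (λ a → :- (:- a) := a) ≡.refl a)
        (ℚ.neg-antimono-≤ (≡.subst (0ℚ ℚ.≤_) e (ℚ.0≤∣p∣ a)))

    <⇒∣∣< : ∀ {a ε} → a ℚ.< ε → ℚ.- a ℚ.< ε → ℚ.∣ a ∣ ℚ.< ε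
    <⇒∣∣< {a} {ε} h h′ with ℚ.∣p∣≡p∨∣p∣≡-p a
    ... | inj₁ e = ≡.subst (ℚ._< ε) (≡.sym e) h
    ... | inj₂ e = ≡.subst (ℚ._< ε) (≡.sym e) h′

    ∣-∣-sym : ∀ a b → ℚ.∣ a ℚ.- b ∣ ≡ ℚ.∣ b ℚ.- a ∣
    ∣-∣-sym a b = ≡.trans (≡.cong ℚ.∣_∣ (solve 2 (λ a b → a :- b := :- (b :- a)) ≡.refl a b))
        (ℚ.∣-p∣≡∣p∣ (b ℚ.- a))

    ∣-∣-triangle : ∀ a b c {δ ε} → ℚ.∣ a ℚ.- b ∣ ℚ.< δ → ℚ.∣ b ℚ.- c ∣ ℚ.< ε →
      ℚ.∣ a ℚ.- c ∣ ℚ.< δ ℚ.+ ε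
    ∣-∣-triangle a b c {δ} {ε} p q = begin-strict
      ℚ.∣ a ℚ.- c ∣ ≡⟨ ≡.cong ℚ.∣_∣ (solve 3 (λ a b c → a :- c := (a :- b) :+ (b :- c))
          ≡.refl a b c) ⟩
      ℚ.∣ (a ℚ.- b) ℚ.+ (b ℚ.- c) ∣ ≤⟨ ℚ.∣p+q∣≤∣p∣+∣q∣ (a ℚ.- b) (b ℚ.- c) ⟩
      ℚ.∣ a ℚ.- b ∣ ℚ.+ ℚ.∣ b ℚ.- c ∣ <⟨ ℚ.+-mono-< p q ⟩
      δ ℚ.+ ε ∎
      where open ℚ.≤-Reasoning

    ½>0 : ∀ {ε} → 0ℚ ℚ.< ε → 0ℚ ℚ.< ℚ.½ ℚ.* ε
    ½>0 = ℚ.*-monoʳ-<-pos ℚ.½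

    ½+½ : ∀ ε → ℚ.½ ℚ.* ε ℚ.+ ℚ.½ ℚ.* ε ≡ ε
    ½+½ ε = ≡.trans (≡.sym (ℚ.*-distribʳ-+ ε ℚ.½ ℚ.½)) (ℚ.*-identityˡ ε)

    *>0 : ∀ {p q} → 0ℚ ℚ.< p → 0ℚ ℚ.< q → 0ℚ ℚ.< p ℚ.* q
    *>0 {p} {q} 0<p 0<q = ℚ.positive⁻¹ (p ℚ.* q)
        {{ℚ.pos*pos⇒pos p {{ℚ.positive 0<p}} q {{ℚ.positive 0<q}}}}

    +>0 : ∀ {p q} → 0ℚ ℚ.< p → 0ℚ ℚ.< q → 0ℚ ℚ.< p ℚ.+ q
    +>0 = ℚ.+-mono-<

    eventually-bounded : ∀ x → ∃[ B ] 0ℚ ℚ.< B × Eventually (λ n → ℚ.∣ D.seq x n ∣ ℚ.< B)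
    eventually-bounded x with N , close ← D.cauchy x 1ℚ (ℚ.positive⁻¹ 1ℚ) =
      1ℚ ℚ.+ ℚ.∣ a ∣ , ℚ.+-mono-<-≤ (ℚ.positive⁻¹ 1ℚ) (ℚ.0≤∣p∣ a) , N , λ n le → begin-strict
        ℚ.∣ D.seq x n ∣ ≡⟨ ≡.cong ℚ.∣_∣ (solve 2 (λ a b → b := (b :- a) :+ a) ≡.refl a
            (D.seq x n)) ⟩
        ℚ.∣ (D.seq x n ℚ.- a) ℚ.+ a ∣ ≤⟨ ℚ.∣p+q∣≤∣p∣+∣q∣ (D.seq x n ℚ.- a) a ⟩
        ℚ.∣ D.seq x n ℚ.- a ∣ ℚ.+ ℚ.∣ a ∣ <⟨ ℚ.+-monoˡ-< ℚ.∣ a ∣ (close n N le ℕ.≤-refl) ⟩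
        1ℚ ℚ.+ ℚ.∣ a ∣ ∎
      where
      open ℚ.≤-Reasoning
      a = D.seq x N

    pointwise : ∀ x y → (∀ n → D.seq x n ≡ D.seq y n) → x D.≈ y
    pointwise x y h ε 0<ε = alwaysE λ n → ≡.subst (λ d → ℚ.∣ d ∣ ℚ.< ε)
      (≡.sym (≡.trans (≡.cong (ℚ._- D.seq y n) (h n)) (ℚ.+-inverseʳ (D.seq y n)))) 0<ε

    ≈-sym : ∀ {x y} → x D.≈ y → y D.≈ x
    ≈-sym {x} {y} h ε 0<ε = mapE (λ n → ≡.subst (ℚ._< ε) (∣-∣-sym (D.seq x n) (D.seq y n)))
        (h ε 0<ε)

    ≈-trans : ∀ {x y z} → x D.≈ y → y D.≈ z → x D.≈ z
    ≈-trans {x} {y} {z} p q ε 0<ε = zipE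
      (λ n u v → ≡.subst (ℚ.∣ D.seq x n ℚ.- D.seq z n ∣ ℚ.<_) (½+½ ε)
          (∣-∣-triangle (D.seq x n) (D.seq y n) (D.seq z n) u v))
      (p _ (½>0 0<ε)) (q _ (½>0 0<ε))

    +-congˡ : ∀ x y z → x D.≈ y → x D.+ z D.≈ y D.+ z
    +-congˡ x y z h ε 0<ε = mapE (λ n → ≡.subst (λ d → ℚ.∣ d ∣ ℚ.< ε)
      (solve 3 (λ x y z → x :- y := (x :+ z) :- (y :+ z)) ≡.refl (D.seq x n) (D.seq y n)
          (D.seq z n))) (h ε 0<ε)

    +-comm : ∀ x y → x D.+ y D.≈ y D.+ x
    +-comm x y = pointwise (x D.+ y) (y D.+ x) λ n → ℚ.+-comm (D.seq x n) (D.seq y n)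

    *-comm : ∀ x y → x D.* y D.≈ y D.* x
    *-comm x y = pointwise (x D.* y) (y D.* x) λ n → ℚ.*-comm (D.seq x n) (D.seq y n)

    +-cong : ∀ {x y u v} → x D.≈ y → u D.≈ v → x D.+ u D.≈ y D.+ v
    +-cong {x} {y} {u} {v} p q =
      ≈-trans {x D.+ u} {y D.+ u} {y D.+ v} (+-congˡ x y u p)
        (≈-trans {y D.+ u} {u D.+ y} {y D.+ v} (+-comm y u)
          (≈-trans {u D.+ y} {v D.+ y} {y D.+ v} (+-congˡ u v y q) (+-comm v y)))

    divide : ∀ B ε → 0ℚ ℚ.< B → 0ℚ ℚ.< ε → ∃[ δ ] 0ℚ ℚ.< δ × B ℚ.* δ ≡ ε
    divide B ε 0<B 0<ε = ℚ.1/ B ℚ.* ε ,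
      *>0 {ℚ.1/ B} {ε} (ℚ.positive⁻¹ (ℚ.1/ B) {{ℚ.1/pos⇒pos B}}) 0<ε ,
      (begin
        B ℚ.* (ℚ.1/ B ℚ.* ε) ≡⟨ ℚ.*-assoc B (ℚ.1/ B) ε ⟨
        B ℚ.* ℚ.1/ B ℚ.* ε ≡⟨ ≡.cong (ℚ._* ε) (ℚ.*-inverseʳ B) ⟩
        1ℚ ℚ.* ε ≡⟨ ℚ.*-identityˡ ε ⟩
        ε ∎)
      where
      open ≡.≡-Reasoning
      instance
        B-pos : ℚ.Positive B
        B-pos = ℚ.positive 0<B
        B-nz : ℚ.NonZero B
        B-nz = ℚ.pos⇒nonZero B

    *-close : ∀ a b c {B δ} → ℚ.∣ c ∣ ℚ.< B → ℚ.∣ a ℚ.- b ∣ ℚ.< δ →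
      ℚ.∣ a ℚ.* c ℚ.- b ℚ.* c ∣ ℚ.< B ℚ.* δ
    *-close a b c {B} {δ} u v = begin-strict
      ℚ.∣ a ℚ.* c ℚ.- b ℚ.* c ∣ ≡⟨ ≡.cong ℚ.∣_∣
          (solve 3 (λ a b c → a :* c :- b :* c := c :* (a :- b)) ≡.refl a b c) ⟩
      ℚ.∣ c ℚ.* (a ℚ.- b) ∣ ≡⟨ ℚ.∣p*q∣≡∣p∣*∣q∣ c (a ℚ.- b) ⟩
      ℚ.∣ c ∣ ℚ.* ℚ.∣ a ℚ.- b ∣ ≤⟨ ℚ.*-monoʳ-≤-nonNeg ℚ.∣ a ℚ.- b ∣
          {{ℚ.nonNegative (ℚ.0≤∣p∣ (a ℚ.- b))}} (ℚ.<⇒≤ u) ⟩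
      B ℚ.* ℚ.∣ a ℚ.- b ∣ <⟨ ℚ.*-monoʳ-<-pos B {{ℚ.positive (ℚ.≤-<-trans (ℚ.0≤∣p∣ c) u)}} v ⟩
      B ℚ.* δ ∎
      where open ℚ.≤-Reasoning

    *-congˡ : ∀ x y z → x D.≈ y → x D.* z D.≈ y D.* z
    *-congˡ x y z h ε 0<ε =
      let B , 0<B , bound = eventually-bounded z
          δ , 0<δ , Bδ≡ε = divide B ε 0<B 0<ε
      in zipE
        {λ n → ℚ.∣ D.seq z n ∣ ℚ.< B}
        {λ n → ℚ.∣ D.seq x n ℚ.- D.seq y n ∣ ℚ.< δ}
        {λ n → ℚ.∣ D.seq x n ℚ.* D.seq z n ℚ.- D.seq y n ℚ.* D.seq z n ∣ ℚ.< ε}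
        (λ n u v → ≡.subst (λ e → ℚ.∣ D.seq x n ℚ.* D.seq z n ℚ.- D.seq y n ℚ.* D.seq z n ∣ ℚ.< e)
            Bδ≡ε
          (*-close (D.seq x n) (D.seq y n) (D.seq z n) u v))
        bound (h δ 0<δ)

    *-cong : ∀ {x y u v} → x D.≈ y → u D.≈ v → x D.* u D.≈ y D.* v
    *-cong {x} {y} {u} {v} p q =
      ≈-trans {x D.* u} {y D.* u} {y D.* v} (*-congˡ x y u p)
        (≈-trans {y D.* u} {u D.* y} {y D.* v} (*-comm y u)
          (≈-trans {u D.* y} {v D.* y} {y D.* v} (*-congˡ u v y q) (*-comm v y)))

    neg-cong : ∀ {x y} → x D.≈ y → D.- x D.≈ D.- y
    neg-cong {x} {y} h ε 0<ε = mapE (λ n → ≡.subst (ℚ._< ε)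
      (≡.trans (≡.sym (ℚ.∣-p∣≡∣p∣ (D.seq x n ℚ.- D.seq y n)))
          (≡.cong ℚ.∣_∣ (ℚ.neg-distrib-+ (D.seq x n) (ℚ.- D.seq y n))))) (h ε 0<ε)

    ≈-isEquivalence : IsEquivalence D._≈_
    ≈-isEquivalence = record
      { refl = λ {x} → pointwise x x λ _ → ≡.refl
      ; sym = λ {x} {y} → ≈-sym {x} {y}
      ; trans = λ {x} {y} {z} → ≈-trans {x} {y} {z}
      }

    ℝ-isCommutativeRing : IsCommutativeRing D._≈_ D._+_ D._*_ D.-_ (D.fromℚ 0ℚ) (D.fromℚ 1ℚ)
    ℝ-isCommutativeRing = record
      { isRing = record
        { +-isAbelianGroup = record
          { isGroup = record
            { isMonoid = record
              { isSemigroup = record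
                { isMagma = record
                  { isEquivalence = ≈-isEquivalence
                  ; ∙-cong = λ {x} {y} {u} {v} → +-cong {x} {y} {u} {v}
                  }
                ; assoc = λ x y z → pointwise (x D.+ y D.+ z) (x D.+ (y D.+ z)) λ n → ℚ.+-assoc
                    (D.seq x n) (D.seq y n) (D.seq z n)
                }
              ; identity = (λ x → pointwise (D.0ℝ D.+ x) x λ n → ℚ.+-identityˡ (D.seq x n))
                         , (λ x → pointwise (x D.+ D.0ℝ) x λ n → ℚ.+-identityʳ (D.seq x n))
              }
            ; inverse = (λ x → pointwise (D.- x D.+ x) D.0ℝ λ n → ℚ.+-inverseˡ (D.seq x n))
                      , (λ x → pointwise (x D.+ D.- x) D.0ℝ λ n → ℚ.+-inverseʳ (D.seq x n))
            ; ⁻¹-cong = λ {x} {y} → neg-cong {x} {y}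
            }
          ; comm = +-comm
          }
        ; *-cong = λ {x} {y} {u} {v} → *-cong {x} {y} {u} {v}
        ; *-assoc = λ x y z → pointwise (x D.* y D.* z) (x D.* (y D.* z)) λ n → ℚ.*-assoc
            (D.seq x n) (D.seq y n) (D.seq z n)
        ; *-identity = (λ x → pointwise (D.1ℝ D.* x) x λ n → ℚ.*-identityˡ (D.seq x n))
                     , (λ x → pointwise (x D.* D.1ℝ) x λ n → ℚ.*-identityʳ (D.seq x n))
        ; distrib = (λ x y z → pointwise (x D.* (y D.+ z)) (x D.* y D.+ x D.* z) λ n →
            ℚ.*-distribˡ-+ (D.seq x n) (D.seq y n) (D.seq z n))
                  , (λ x y z → pointwise ((y D.+ z) D.* x) (y D.* x D.+ z D.* x) λ n →
                      ℚ.*-distribʳ-+ (D.seq x n) (D.seq y n) (D.seq z n))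
        }
      ; *-comm = *-comm
      }

    <-irrefl : ∀ {x y} → x D.≈ y → ¬ x D.< y
    <-irrefl {x} {y} x≈y (ε , 0<ε , x<y) =
      let N , h = zipE (λ n → step n) (x≈y ε 0<ε) x<y in h N ℕ.≤-refl
      where
      step : ∀ n → ℚ.∣ D.seq x n ℚ.- D.seq y n ∣ ℚ.< ε → ¬ D.seq x n ℚ.+ ε ℚ.< D.seq y n
      step n p q = ℚ.<-irrefl ≡.refl (≡.subst (0ℚ ℚ.<_)
        (solve 3 (λ a b e → (e :- (:- (a :- b))) :+ (b :- (a :+ e)) := con (+ 0)) ≡.refl
            (D.seq x n) (D.seq y n) ε)
        (+>0 (<⇒0< (proj₂ (∣∣<⇒< p))) (<⇒0< q)))

    <-trans : ∀ {x y z} → x D.< y → y D.< z → x D.< z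
    <-trans {x} {y} {z} (ε , 0<ε , p) (δ , 0<δ , q) = ε , 0<ε , zipE
      (λ n u v → ℚ.<-trans u (ℚ.<-trans (0<⇒< (≡.subst (0ℚ ℚ.<_)
        (solve 2 (λ a d → d := (a :+ d) :- a) ≡.refl (D.seq y n) δ) 0<δ)) v)) p q

    eighth : ∀ {ε} → 0ℚ ℚ.< ε → ∃[ η ] 0ℚ ℚ.< η × ε ≡ (+ 8 ℚ./ 1) ℚ.* η
    eighth {ε} 0<ε = (+ 1 ℚ./ 8) ℚ.* ε , ℚ.*-monoʳ-<-pos (+ 1 ℚ./ 8) 0<ε ,
      ≡.trans (≡.sym (ℚ.*-identityˡ ε)) (ℚ.*-assoc (+ 8 ℚ./ 1) (+ 1 ℚ./ 8) ε)

    near : ∀ x {η} → 0ℚ ℚ.< η → ∃[ N ] ∀ m n → N ℕ.≤ m → N ℕ.≤ n →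
      0ℚ ℚ.< η ℚ.- (D.seq x m ℚ.- D.seq x n)
    near x {η} 0<η with N , h ← D.cauchy x η 0<η = N , λ m n p q → <⇒0< (proj₁ (∣∣<⇒< (h m n p q)))

    near₂ : ∀ x y {η} → 0ℚ ℚ.< η → ∃[ N ] ∀ m n → N ℕ.≤ m → N ℕ.≤ n →
      0ℚ ℚ.< η ℚ.- (D.seq x m ℚ.- D.seq x n) × 0ℚ ℚ.< η ℚ.- (D.seq y m ℚ.- D.seq y n)
    near₂ x y 0<η with M , h ← near x 0<η | N , k ← near y 0<η = M ℕ.⊔ N , λ m n p q →
      h m n (ℕ.m⊔n≤o⇒m≤o M N p) (ℕ.m⊔n≤o⇒m≤o M N q) , k m n (ℕ.m⊔n≤o⇒n≤o M N p) (ℕ.m⊔n≤o⇒n≤o M N q)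

    -- Beyond `N` each sequence moves by less than η, so a margin of 4η at the single index `N`
    -- leaves more than η at every later one. Strict order thus follows from one decidable rational
    -- test, on which cotransitivity and tightness both rest.
    apart-at : ∀ x y {η} → 0ℚ ℚ.< η → (N : ℕ) →
      (∀ m n → N ℕ.≤ m → N ℕ.≤ n →
        0ℚ ℚ.< η ℚ.- (D.seq x m ℚ.- D.seq x n) × 0ℚ ℚ.< η ℚ.- (D.seq y m ℚ.- D.seq y n)) →
      D.seq x N ℚ.+ (+ 4 ℚ./ 1) ℚ.* η ℚ.≤ D.seq y N → x D.< y
    apart-at x y {η} 0<η N close h = η , 0<η , N , λ n le →
      let p = proj₁ (close n N le ℕ.≤-refl)
          q = proj₂ (close N n ℕ.≤-refl le)
      in 0<⇒< (≡.subst (0ℚ ℚ.<_)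
        (solve 5 (λ xn yn xN yN e →
          ((e :- (xn :- xN)) :+ (e :- (yN :- yn))) :+ (e :+ (yN :- (xN :+ con (+ 4) :* e)))
          := yn :- (xn :+ e)) ≡.refl (D.seq x n) (D.seq y n) (D.seq x N) (D.seq y N) η)
        (+>0 (+>0 p q) (ℚ.+-mono-<-≤ 0<η (≤⇒0≤ h))))

    <-cotrans : ∀ {x y} → x D.< y → ∀ z → x D.< z ⊎ z D.< y
    <-cotrans {x} {y} (ε , 0<ε , N₀ , gap) z
      with η , 0<η , ≡.refl ← eighth 0<ε
      with N₁ , close₁ ← near₂ x z 0<η | N₂ , close₂ ← near₂ z y 0<η
      = decide
      where
      N = N₀ ℕ.⊔ (N₁ ℕ.⊔ N₂)
      N₁₂≤N = ℕ.m≤n⊔m N₀ (N₁ ℕ.⊔ N₂)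
      N₁≤N = ℕ.≤-trans (ℕ.m≤m⊔n N₁ N₂) N₁₂≤N
      N₂≤N = ℕ.≤-trans (ℕ.m≤n⊔m N₁ N₂) N₁₂≤N
      decide : x D.< z ⊎ z D.< y
      decide with D.seq x N ℚ.+ (+ 4 ℚ./ 1) ℚ.* η ℚ.≤? D.seq z N
      -- The gap of 8η between `x` and `y` at `N` leaves a margin of 4η on at least one side of `z`.
      ... | yes h = inj₁ (apart-at x z 0<η N (λ m n p q → close₁ m n (ℕ.≤-trans N₁≤N p)
          (ℕ.≤-trans N₁≤N q)) h)
      ... | no ¬h = inj₂ (apart-at z y 0<η N (λ m n p q → close₂ m n (ℕ.≤-trans N₂≤N p)
          (ℕ.≤-trans N₂≤N q))
        (ℚ.<⇒≤ (0<⇒< (≡.subst (0ℚ ℚ.<_)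
          (solve 4 (λ a b c e → (b :- (a :+ con (+ 8) :* e)) :+ ((a :+ con (+ 4) :* e) :- c)
             := b :- (c :+ con (+ 4) :* e)) ≡.refl (D.seq x N) (D.seq y N) (D.seq z N) η)
          (+>0 (<⇒0< (gap N (ℕ.m≤m⊔n N₀ (N₁ ℕ.⊔ N₂)))) (<⇒0< (ℚ.≰⇒> ¬h)))))))

    tight : ∀ {x y} → ¬ x D.< y → ¬ y D.< x → x D.≈ y
    tight {x} {y} x≮y y≮x ε 0<ε
      with η , 0<η , ≡.refl ← eighth 0<ε
      with N , close ← near₂ x y 0<η = N , λ n le → <⇒∣∣<
        (0<⇒< (≡.subst (0ℚ ℚ.<_)
          (solve 5 (λ xn yn xN yN e →
            (((e :- (xn :- xN)) :+ (e :- (yN :- yn))) :+ ((yN :+ con (+ 4) :* e) :- xN)) :+ (e :+ e)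
            := con (+ 8) :* e :- (xn :- yn)) ≡.refl (D.seq x n) (D.seq y n) (D.seq x N)
                (D.seq y N) η)
          (+>0 (+>0 (+>0 (proj₁ (close n N le ℕ.≤-refl)) (proj₂ (close N n ℕ.≤-refl le)))
            (<⇒0< (ℚ.≰⇒> λ h → y≮x (apart-at y x 0<η N (λ m n p q → swap (close m n p q)) h))))
                (+>0 0<η 0<η))))
        (0<⇒< (≡.subst (0ℚ ℚ.<_)
          (solve 5 (λ xn yn xN yN e →
            (((e :- (xN :- xn)) :+ (e :- (yn :- yN))) :+ ((xN :+ con (+ 4) :* e) :- yN)) :+ (e :+ e)
            := con (+ 8) :* e :- (:- (xn :- yn))) ≡.refl (D.seq x n) (D.seq y n) (D.seq x N)
                (D.seq y N) η)
          (+>0 (+>0 (+>0 (proj₁ (close N n ℕ.≤-refl le)) (proj₂ (close n N le ℕ.≤-refl)))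
            (<⇒0< (ℚ.≰⇒> λ h → x≮y (apart-at x y 0<η N close h)))) (+>0 0<η 0<η))))

    +-monoˡ-< : ∀ z {x y} → x D.< y → x D.+ z D.< y D.+ z
    +-monoˡ-< z {x} {y} (ε , 0<ε , h) = ε , 0<ε , mapE
        (λ n p → ≡.subst (ℚ._< D.seq y n ℚ.+ D.seq z n)
      (solve 3 (λ a e c → (a :+ e) :+ c := (a :+ c) :+ e) ≡.refl (D.seq x n) ε (D.seq z n))
          (ℚ.+-monoˡ-< (D.seq z n) p)) h

    *-pos : ∀ {x y} → D.0ℝ D.< x → D.0ℝ D.< y → D.0ℝ D.< x D.* y
    *-pos {x} {y} (ε , 0<ε , p) (δ , 0<δ , q) = ε ℚ.* δ , *>0 0<ε 0<δ , zipE (λ n u v → begin-strict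
        0ℚ ℚ.+ ε ℚ.* δ ≡⟨ ℚ.+-identityˡ (ε ℚ.* δ) ⟩
        ε ℚ.* δ <⟨ ℚ.*-monoʳ-<-pos ε {{ℚ.positive 0<ε}}
            (≡.subst (ℚ._< D.seq y n) (ℚ.+-identityˡ δ) v) ⟩
        ε ℚ.* D.seq y n <⟨ ℚ.*-monoˡ-<-pos (D.seq y n)
            {{ℚ.positive (ℚ.<-trans 0<δ (≡.subst (ℚ._< D.seq y n) (ℚ.+-identityˡ δ) v))}}
                (≡.subst (ℚ._< D.seq x n) (ℚ.+-identityˡ ε) u) ⟩
        D.seq x n ℚ.* D.seq y n ∎) p q
      where open ℚ.≤-Reasoning

    fromℚ-< : ∀ {p q} → p ℚ.< q → D.fromℚ p D.< D.fromℚ q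
    fromℚ-< {p} {q} p<q = h , ½>0 (<⇒0< p<q) , alwaysE λ _ → 0<⇒<
      (≡.subst (0ℚ ℚ.<_) (≡.trans (solve 1 (λ h → h := h :+ h :- h) ≡.refl h)
        (≡.trans (≡.cong (ℚ._- h) (½+½ (q ℚ.- p)))
            (solve 3 (λ p q h → q :- p :- h := q :- (p :+ h)) ≡.refl p q h))) (½>0 (<⇒0< p<q)))
      where h = ℚ.½ ℚ.* (q ℚ.- p)

    bound-above : ∀ q → ∃[ n ] q ℚ.≤ + n ℚ./ 1
    bound-above q = ℤ.∣ ℚ.↥ q ∣ , Cast.≤∣↥∣ q

    archimedean : ∀ x → ∃[ n ] x D.< D.fromℚ (+ n ℚ./ 1)
    archimedean x =
      let B , 0<B , bound = eventually-bounded x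
          n , 1+B≤n = bound-above (1ℚ ℚ.+ B)
      in n , 1ℚ , ℚ.positive⁻¹ 1ℚ ,
        mapE {λ m → ℚ.∣ D.seq x m ∣ ℚ.< B} {λ m → D.seq x m ℚ.+ 1ℚ ℚ.< + n ℚ./ 1}
          (λ m h → ℚ.<-≤-trans {D.seq x m ℚ.+ 1ℚ} {1ℚ ℚ.+ B} {+ n ℚ./ 1}
            (≡.subst (ℚ._< 1ℚ ℚ.+ B) (ℚ.+-comm 1ℚ (D.seq x m)) (ℚ.+-monoʳ-< 1ℚ (proj₁ (∣∣<⇒< h))))
                1+B≤n) bound

    archimedean′ : ∀ {x} → D.0ℝ D.< x → ∃[ n ] D.1ℝ D.< D.fromℕ n D.* x
    archimedean′ {x} (ε , 0<ε , h) =
      let δ , 0<δ , εδ≡1 = divide ε 1ℚ 0<ε (ℚ.positive⁻¹ 1ℚ)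
          -- Twice 1/ε, so that the product exceeds 2 and the strict inequality keeps a gap of 1.
          n , δ+δ≤n = bound-above (δ ℚ.+ δ)
      in n , 1ℚ , ℚ.positive⁻¹ 1ℚ ,
        mapE {λ m → 0ℚ ℚ.+ ε ℚ.< D.seq x m} {λ m → 1ℚ ℚ.+ 1ℚ ℚ.< + n ℚ./ 1 ℚ.* D.seq x m}
            (λ m → step δ n (D.seq x m) 0<δ εδ≡1 δ+δ≤n) h
      where
      step : ∀ δ n a → 0ℚ ℚ.< δ → ε ℚ.* δ ≡ 1ℚ → δ ℚ.+ δ ℚ.≤ + n ℚ./ 1 → 0ℚ ℚ.+ ε ℚ.< a →
        1ℚ ℚ.+ 1ℚ ℚ.< + n ℚ./ 1 ℚ.* a
      step δ n a 0<δ e δ+δ≤n ε<a = begin-strict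
        1ℚ ℚ.+ 1ℚ ≡⟨ ≡.cong₂ ℚ._+_ (≡.sym e) (≡.sym e) ⟩
        ε ℚ.* δ ℚ.+ ε ℚ.* δ ≡⟨ solve 2 (λ a d → a :* d :+ a :* d := (d :+ d) :* a) ≡.refl ε δ ⟩
        (δ ℚ.+ δ) ℚ.* ε <⟨ ℚ.*-monoʳ-<-pos (δ ℚ.+ δ) {{ℚ.positive (+>0 0<δ 0<δ)}} ε<a′ ⟩
        (δ ℚ.+ δ) ℚ.* a ≤⟨ ℚ.*-monoʳ-≤-nonNeg a {{ℚ.nonNegative (ℚ.<⇒≤ (ℚ.<-trans 0<ε ε<a′))}}
            δ+δ≤n ⟩
        + n ℚ./ 1 ℚ.* a ∎
        where
        open ℚ.≤-Reasoning
        ε<a′ : ε ℚ.< a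
        ε<a′ = ≡.subst (ℚ._< a) (ℚ.+-identityˡ ε) ε<a

    fromℚ-cong : ∀ {p q} → p ≡ q → D.fromℚ p D.≈ D.fromℚ q
    fromℚ-cong {p} {q} e = pointwise (D.fromℚ p) (D.fromℚ q) λ _ → e

  ℝ-field : OrderedField
  ℝ-field = record
    { Carrier = D.ℝ
    ; _≈_ = D._≈_
    ; _<_ = D._<_
    ; _+_ = D._+_
    ; _*_ = D._*_
    ; -_ = D.-_
    ; int = λ i → D.fromℚ (i ℚ./ 1)
    ; recip = λ n → D.1/ℕ n
    ; isCommutativeRing = ℝ-isCommutativeRing
    ; int-+ = λ i j → fromℚ-cong (Cast./1-+ i j)
    ; int-* = λ i j → fromℚ-cong (Cast./1-* i j)
    ; int-neg = λ i → fromℚ-cong (Cast./1-neg i)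
    ; recip-inverse = λ n → fromℚ-cong (Cast./1-inverse n)
    ; recip-pos = λ n → fromℚ-< (ℚ.positive⁻¹ (+ 1 ℚ./ n) {{ℚ.normalize-pos 1 n}})
    ; <-irrefl = λ {x} {y} → <-irrefl {x} {y}
    ; <-trans = λ {x} {y} {z} → <-trans {x} {y} {z}
    ; <-cotrans = λ {x} {y} → <-cotrans {x} {y}
    ; tight = λ {x} {y} → tight {x} {y}
    ; 0<1 = fromℚ-< (ℚ.positive⁻¹ 1ℚ)
    ; +-monoˡ-< = λ z {x} {y} → +-monoˡ-< z {x} {y}
    ; *-pos = λ {x} {y} → *-pos {x} {y}
    ; archimedean = archimedean
    ; archimedean′ = λ {x} → archimedean′ {x}
    }

open RealField using (ℝ-field)

-- Order and finite sums in an ordered field.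

module Ordered (F : OrderedField) where

  open OrderedField F public

  commutativeRing : CommutativeRing 0ℓ 0ℓ
  commutativeRing = record { isCommutativeRing = isCommutativeRing }

  open CommutativeRing commutativeRing public
    using (0#; 1#; _-_; refl; sym; trans; reflexive; setoid; semiring;
      +-cong; +-congˡ; +-congʳ; +-comm; +-identityˡ; +-identityʳ; -‿cong; -‿inverseʳ;
      *-cong; *-congˡ; *-congʳ; *-comm; *-assoc; *-identityˡ; *-identityʳ;
      zeroˡ; zeroʳ; distribˡ; distribʳ)
  open Algebra.Properties.Semiring.Sum semiring public
    using (sum; sum-cong-≋; ∑-comm; *-distribˡ-sum; sum-replicate-zero)

  infix 4 _≤_
  _≤_ : Carrier → Carrier → Set
  x ≤ y = ¬ y < x

  int-morphism : ℤ.+-*-rawRing -Raw-AlmostCommutative⟶ fromCommutativeRing commutativeRing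
  int-morphism = record
    { ⟦_⟧ = int
    ; +-homo = int-+
    ; *-homo = int-*
    ; -‿homo = int-neg
    ; 0-homo = refl
    ; 1-homo = refl
    }

  open Cast.IntegerSolver commutativeRing int-morphism public
    using (solve; con; _:=_; _:+_; _:-_; _:*_; :-_)

  <-resp : ∀ {x x′ y y′} → x ≈ x′ → y ≈ y′ → x < y → x′ < y′
  <-resp {x} {x′} {y} {y′} p q x<y with <-cotrans x<y x′
  ... | inj₁ x<x′ = ⊥-elim (<-irrefl p x<x′)
  ... | inj₂ x′<y with <-cotrans x′<y y′
  ... | inj₁ r = r
  ... | inj₂ y′<y = ⊥-elim (<-irrefl (sym q) y′<y)

  <-asym : ∀ {x y} → x < y → ¬ y < x
  <-asym p q = <-irrefl refl (<-trans p q)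

  ≤-resp : ∀ {x x′ y y′} → x ≈ x′ → y ≈ y′ → x ≤ y → x′ ≤ y′
  ≤-resp p q h = h ∘ <-resp (sym q) (sym p)

  ≤-reflexive : ∀ {x y} → x ≈ y → x ≤ y
  ≤-reflexive p = <-irrefl (sym p)

  ≤-refl : ∀ {x} → x ≤ x
  ≤-refl = ≤-reflexive refl

  <⇒≤ : ∀ {x y} → x < y → x ≤ y
  <⇒≤ = <-asym

  ≤-antisym : ∀ {x y} → x ≤ y → y ≤ x → x ≈ y
  ≤-antisym p q = tight q p

  <-≤-trans : ∀ {x y z} → x < y → y ≤ z → x < z
  <-≤-trans {z = z} p q with <-cotrans p z
  ... | inj₁ r = r
  ... | inj₂ r = ⊥-elim (q r)

  ≤-<-trans : ∀ {x y z} → x ≤ y → y < z → x < z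
  ≤-<-trans {x} p q with <-cotrans q x
  ... | inj₁ r = ⊥-elim (p r)
  ... | inj₂ r = r

  ≤-trans : ∀ {x y z} → x ≤ y → y ≤ z → x ≤ z
  ≤-trans p q z<x = p (≤-<-trans q z<x)

  <⇒0< : ∀ {x y} → x < y → 0# < y - x
  <⇒0< {x} {y} p = <-resp (-‿inverseʳ x) refl (+-monoˡ-< (- x) p)

  0<⇒< : ∀ {x y} → 0# < y - x → x < y
  0<⇒< {x} {y} p = <-resp (+-identityˡ x) (solve 2 (λ x y → (y :- x) :+ x := y) refl x y)
      (+-monoˡ-< x p)

  0≤⇒≤ : ∀ {x y} → 0# ≤ y - x → x ≤ y
  0≤⇒≤ {x} {y} h p = h (<-resp refl (-‿inverseʳ x) (+-monoˡ-< (- x) p))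

  ≤⇒0≤ : ∀ {x y} → x ≤ y → 0# ≤ y - x
  ≤⇒0≤ {x} {y} h p = h (<-resp (solve 2 (λ x y → (y :- x) :+ x := y) refl x y) (+-identityˡ x)
      (+-monoˡ-< x p))

  +-mono-≤ : ∀ {x y u v} → x ≤ y → u ≤ v → x + u ≤ y + v
  +-mono-≤ {x} {y} {u} {v} p q = ≤-trans
    (λ h → p (0<⇒< (<-resp refl (solve 3 (λ x y u → x :+ u :- (y :+ u) := x :- y) refl x y
        u) (<⇒0< h))))
    (λ h → q (0<⇒< (<-resp refl (solve 3 (λ u v y → y :+ u :- (y :+ v) := u :- v) refl u v
        y) (<⇒0< h))))

  +-nonneg : ∀ {x y} → 0# ≤ x → 0# ≤ y → 0# ≤ x + y
  +-nonneg p q = ≤-resp (+-identityˡ 0#) refl (+-mono-≤ p q)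

  +-pos : ∀ {x y} → 0# < x → 0# ≤ y → 0# < x + y
  +-pos {x} {y} p q = <-≤-trans p (0≤⇒≤ (≤-resp refl (solve 2 (λ x y → y := x :+ y :- x)
      refl x y) q))

  x≤1+x : ∀ x → x ≤ 1# + x
  x≤1+x x = 0≤⇒≤ (≤-resp refl (solve 1 (λ x → con (+ 1) := con (+ 1) :+ x :- x) refl x) (<⇒≤ 0<1))

  -- The sign of a factor cannot be decided. If the product were negative, neither factor could be
  -- zero, so by `tight` neither could fail to be positive; the conclusion is a negation, so both
  -- double negations can be removed.
  *-nonneg : ∀ {x y} → 0# ≤ x → 0# ≤ y → 0# ≤ x * y
  *-nonneg {x} {y} p q xy<0 = ¬¬0<x λ 0<x → ¬¬0<y λ 0<y → <-asym xy<0 (*-pos 0<x 0<y)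
    where
    ¬¬0<x : ¬ ¬ 0# < x
    ¬¬0<x h = <-irrefl (trans (*-congʳ {y} (tight p h)) (zeroˡ y)) xy<0
    ¬¬0<y : ¬ ¬ 0# < y
    ¬¬0<y h = <-irrefl (trans (*-congˡ {x} (tight q h)) (zeroʳ x)) xy<0

  *-monoʳ-≤ : ∀ {x y z} → 0# ≤ z → x ≤ y → z * x ≤ z * y
  *-monoʳ-≤ {x} {y} {z} p q = 0≤⇒≤ (≤-resp refl
    (solve 3 (λ x y z → z :* (y :- x) := z :* y :- z :* x) refl x y z) (*-nonneg p (≤⇒0≤ q)))

  *-monoˡ-≤ : ∀ {x y z} → 0# ≤ z → x ≤ y → x * z ≤ y * z
  *-monoˡ-≤ {x} {y} {z} p q = ≤-resp (*-comm z x) (*-comm z y) (*-monoʳ-≤ p q)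

  *-cancelˡ-≤ : ∀ {x y z} → 0# < z → z * x ≤ z * y → x ≤ y
  *-cancelˡ-≤ {x} {y} {z} p q h = q (0<⇒< (<-resp refl
    (solve 3 (λ x y z → z :* (x :- y) := z :* x :- z :* y) refl x y z) (*-pos p (<⇒0< h))))

  *-cancelˡ : ∀ {x y z} → 0# < z → z * x ≈ z * y → x ≈ y
  *-cancelˡ p e = ≤-antisym (*-cancelˡ-≤ p (≤-reflexive e)) (*-cancelˡ-≤ p (≤-reflexive (sym e)))

  nat : ℕ → Carrier
  nat n = int (+ n)

  nat-+ : ∀ m n → nat (m ℕ.+ n) ≈ nat m + nat n
  nat-+ m n = int-+ (+ m) (+ n)

  nat-* : ∀ m n → nat (m ℕ.* n) ≈ nat m * nat n
  nat-* m n = trans (reflexive (≡.cong int (ℤ.pos-* m n))) (int-* (+ m) (+ n))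

  nat-nonneg : ∀ n → 0# ≤ nat n
  nat-nonneg zero = ≤-refl
  nat-nonneg (suc n) = ≤-resp refl (sym (nat-+ 1 n)) (+-nonneg (<⇒≤ 0<1) (nat-nonneg n))

  nat-mono-≤ : ∀ {m n} → m ℕ.≤ n → nat m ≤ nat n
  nat-mono-≤ {m} {n} p = 0≤⇒≤ (≤-resp refl (trans
    (solve 2 (λ m o → o := m :+ o :- m) refl (nat m) (nat (n ℕ.∸ m)))
    (+-congʳ (trans (sym (nat-+ m (n ℕ.∸ m))) (reflexive (≡.cong nat (ℕ.m+[n∸m]≡n p))))))
        (nat-nonneg (n ℕ.∸ m)))

  nat-suc : ∀ n → nat (suc n) ≈ 1# + nat n
  nat-suc = nat-+ 1

  nat-pos : ∀ n .{{_ : NonZero n}} → 0# < nat n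
  nat-pos (suc n) = <-resp refl (sym (nat-suc n)) (+-pos 0<1 (nat-nonneg n))

  nat-mono-< : ∀ {m n} → m ℕ.< n → nat m < nat n
  nat-mono-< {m} {n} m<n = <-≤-trans (0<⇒< (<-resp refl (trans
    (solve 1 (λ m → con (+ 1) := con (+ 1) :+ m :- m) refl (nat m))
        (+-congʳ { - nat m} (sym (nat-suc m)))) 0<1)) (nat-mono-≤ m<n)

  nat-injective : ∀ {m n} → nat m ≈ nat n → m ≡ n
  nat-injective {m} {n} e with ℕ.<-cmp m n
  ... | tri< p _ _ = ⊥-elim (<-irrefl e (nat-mono-< p))
  ... | tri≈ _ p _ = p
  ... | tri> _ _ p = ⊥-elim (<-irrefl (sym e) (nat-mono-< p))

  sum-mono : ∀ {n} {f g : Vector Carrier n} → (∀ i → f i ≤ g i) → sum f ≤ sum g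
  sum-mono {zero} h = ≤-refl
  sum-mono {suc n} h = +-mono-≤ (h zero) (sum-mono (h ∘ suc))

  -- The differences `g i - f i` are nonnegative with nonpositive sum. This carries maximality from
  -- a Minkowski sum or a convex combination to each of its parts.
  sum-squeeze : ∀ {n} {f g : Vector Carrier n} → (∀ i → f i ≤ g i) → sum g ≤ sum f → ∀ i → f i ≈ g i
  sum-squeeze {suc n} {f} {g} h e zero = ≤-antisym (h zero) (0≤⇒≤ (≤-resp refl
    (solve 4 (λ a b s t → (a :+ s :- (b :+ t)) :+ (t :- s) := a :- b) refl (f zero) (g zero)
        (sum (f ∘ suc)) (sum (g ∘ suc)))
    (+-nonneg (≤⇒0≤ e) (≤⇒0≤ (sum-mono (h ∘ suc))))))
  sum-squeeze {suc n} {f} {g} h e (suc i) = sum-squeeze (h ∘ suc) (0≤⇒≤ (≤-resp refl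
    (solve 4 (λ a b s t → (a :+ s :- (b :+ t)) :+ (b :- a) := s :- t) refl (f zero) (g zero)
        (sum (f ∘ suc)) (sum (g ∘ suc)))
    (+-nonneg (≤⇒0≤ e) (≤⇒0≤ (h zero))))) i

-- Limits, the exponential series and its functional equation.

module Exp (F : OrderedField) where

  open Ordered F
  open Relation.Binary.Reasoning.Setoid setoid

  -- ∣ a ∣ ≤ b
  Within : Carrier → Carrier → Set
  Within a b = a ≤ b × - a ≤ b

  Within-resp : ∀ {a a′ b b′} → a ≈ a′ → b ≈ b′ → Within a b → Within a′ b′
  Within-resp p q (u , v) = ≤-resp p q u , ≤-resp (-‿cong p) q v

  Within-≤ : ∀ {a b c} → Within a b → b ≤ c → Within a c
  Within-≤ (u , v) p = ≤-trans u p , ≤-trans v p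

  Within-neg : ∀ {a b} → Within a b → Within (- a) b
  Within-neg {a} (u , v) = v , ≤-resp (solve 1 (λ a → a := :- (:- a)) refl a) refl u

  Within-+ : ∀ {a b c d} → Within a b → Within c d → Within (a + c) (b + d)
  Within-+ {a} {b} {c} {d} (u , v) (u′ , v′) = +-mono-≤ u u′ ,
    ≤-resp (solve 2 (λ a c → :- a :+ :- c := :- (a :+ c)) refl a c) refl (+-mono-≤ v v′)

  halve-≤ : ∀ {x y} → x + x ≤ y + y → x ≤ y
  halve-≤ {x} {y} h y<x = h (<-resp (+-comm y y) refl (<-trans (+-monoˡ-< y y<x)
    (<-resp (+-comm y x) refl (+-monoˡ-< x y<x))))

  -- (b - a)(d + c) + (b + a)(d - c) = 2(bd - ac), and likewise for the other sign of c. This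
  -- replaces a case distinction on signs.
  Within-* : ∀ {a b c d} → Within a b → Within c d → Within (a * c) (b * d)
  Within-* {a} {b} {c} {d} (u , v) (u′ , v′) =
      halve-≤ (0≤⇒≤ (≤-resp refl (solve 4 (λ a b c d →
        (b :- a) :* (d :- :- c) :+ (b :- :- a) :* (d :- c) := b :* d :+ b :* d
            :- (a :* c :+ a :* c)) refl a b c d)
        (+-nonneg (*-nonneg (≤⇒0≤ u) (≤⇒0≤ v′)) (*-nonneg (≤⇒0≤ v) (≤⇒0≤ u′)))))
    , halve-≤ (0≤⇒≤ (≤-resp refl (solve 4 (λ a b c d →
        (b :- a) :* (d :- c) :+ (b :- :- a) :* (d :- :- c) := b :* d :+ b :* d
            :- (:- (a :* c) :+ :- (a :* c))) refl a b c d)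
        (+-nonneg (*-nonneg (≤⇒0≤ u) (≤⇒0≤ u′)) (*-nonneg (≤⇒0≤ v) (≤⇒0≤ v′)))))

  Within-cancel : ∀ {a b z} → 0# < z → Within (z * a) (z * b) → Within a b
  Within-cancel {a} {b} {z} p (u , v) = *-cancelˡ-≤ p u ,
    *-cancelˡ-≤ p (≤-resp (solve 2 (λ z a → :- (z :* a) := z :* :- a) refl z a) refl v)

  nonneg⇒Within : ∀ {a b} → 0# ≤ a → a ≤ b → Within a b
  nonneg⇒Within {a} p q = q , ≤-trans (0≤⇒≤
      (≤-resp refl (solve 1 (λ a → a :+ a := a :- (:- a)) refl a) (+-nonneg p p))) q

  bounded : ∀ x → ∃[ n ] Within x (nat n)
  bounded x =
    let m , p = archimedean x
        n , q = archimedean (- x)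
    in m ℕ.+ n , ≤-trans (<⇒≤ p) (nat-mono-≤ (ℕ.m≤m+n m n)) , ≤-trans (<⇒≤ q)
        (nat-mono-≤ (ℕ.m≤n+m n m))

  eventually-exceeds : ∀ x {ε} → 0# < ε → ∃[ N ] ∀ n → N ℕ.≤ n → x < nat n * ε
  eventually-exceeds x {ε} 0<ε =
    let m , x<m = archimedean x
        o , 1<oε = archimedean′ 0<ε
    in m ℕ.* o , λ n le → <-≤-trans x<m (≤-trans
      (≤-resp (trans (*-comm (nat m) 1#) (*-identityˡ (nat m)))
          (trans (sym (*-assoc (nat m) (nat o) ε)) (*-congʳ (sym (nat-* m o))))
        (*-monoʳ-≤ (nat-nonneg m) (<⇒≤ 1<oε)))
      (*-monoˡ-≤ (<⇒≤ 0<ε) (nat-mono-≤ le)))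

  Lim : (ℕ → Carrier) → Carrier → Set
  Lim a ℓ = ∀ ε → 0# < ε → ∃[ N ] ∀ n → N ℕ.≤ n → Within (a n - ℓ) ε

  divide : ∀ n .{{_ : NonZero n}} {ε} → 0# < ε → ∃[ δ ] 0# < δ × nat n * δ ≈ ε
  divide n {ε} 0<ε = recip n * ε , *-pos (recip-pos n) 0<ε ,
    trans (sym (*-assoc (nat n) (recip n) ε)) (trans (*-congʳ (recip-inverse n)) (*-identityˡ ε))

  Lim-cong : ∀ {a b x y} → (∀ n → a n ≈ b n) → x ≈ y → Lim a x → Lim b y
  Lim-cong h p l ε 0<ε = let N , q = l ε 0<ε in
    N , λ n le → Within-resp (+-cong (h n) (-‿cong p)) refl (q n le)

  Lim-eventually : ∀ {a x} → (∃[ N ] ∀ n → N ℕ.≤ n → a n ≈ x) → Lim a x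
  Lim-eventually {a} {x} (N , h) ε 0<ε = N , λ n le → Within-resp
    (trans (sym (-‿inverseʳ x)) (+-congʳ (sym (h n le)))) refl (nonneg⇒Within ≤-refl (<⇒≤ 0<ε))

  Lim-shift : ∀ {a b x} → Lim a x → Lim (λ n → a n - b n) 0# → Lim b x
  Lim-shift {a} {b} {x} p q ε 0<ε =
    let δ , 0<δ , e = divide 2 0<ε
        M , u = p δ 0<δ
        N , v = q δ 0<δ
    in M ℕ.⊔ N , λ n le → Within-resp
      (solve 3 (λ a b x → (a :- x) :+ :- (a :- b :- con (+ 0)) := b :- x) refl (a n) (b n) x)
      (trans (solve 1 (λ d → d :+ d := con (+ 2) :* d) refl δ) e)
      (Within-+ (u n (ℕ.m⊔n≤o⇒m≤o M N le)) (Within-neg (v n (ℕ.m⊔n≤o⇒n≤o M N le))))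

  Lim-neg : (a b : ℕ → Carrier) → Lim (λ n → a n - b n) 0# → Lim (λ n → b n - a n) 0#
  Lim-neg a b h ε 0<ε = let N , k = h ε 0<ε in N , λ n le → Within-resp
    (solve 2 (λ a b → :- (a :- b :- con (+ 0)) := b :- a :- con (+ 0)) refl (a n) (b n)) refl
        (Within-neg (k n le))

  Lim-≤ : ∀ {a b x y} → Lim a x → Lim b y → (∃[ N ] ∀ n → N ℕ.≤ n → a n ≤ b n) → x ≤ y
  Lim-≤ {a} {b} {x} {y} p q (K , h) y<x =
    -- A third of the gap: the two limit errors use up two parts, and the third remains as the
    -- contradiction.
    let δ , 0<δ , e = divide 3 (<⇒0< y<x)
        M , u = p δ 0<δ
        N , v = q δ 0<δ
        n = M ℕ.⊔ N ℕ.⊔ K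
        MN = ℕ.m⊔n≤o⇒m≤o (M ℕ.⊔ N) K (ℕ.≤-refl {n})
        s = +-nonneg (+-nonneg (≤⇒0≤ (proj₂ (u n (ℕ.m⊔n≤o⇒m≤o M N MN))))
            (≤⇒0≤ (proj₁ (v n (ℕ.m⊔n≤o⇒n≤o M N MN)))))
                     (≤⇒0≤ (h n (ℕ.m⊔n≤o⇒n≤o (M ℕ.⊔ N) K (ℕ.≤-refl {n}))))
    in 0≤⇒≤ (≤-resp refl (trans
         (solve 5 (λ a b x y d → ((d :- :- (a :- x)) :+ (d :- (b :- y))) :+ (b :- a) :=
             con (+ 2) :* d :- (x :- y)) refl (a n) (b n) x y δ)
         (trans (+-congˡ (-‿cong (sym e))) (solve 1 (λ d → con (+ 2) :* d :- con (+ 3) :* d :=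
             con (+ 0) :- d) refl δ))) s) 0<δ

  Lim-* : ∀ {a b x y} → Lim a x → Lim b y → Lim (λ n → a n * b n) (x * y)
  Lim-* {a} {b} {x} {y} p q ε 0<ε =
    let A₁ , α = bounded x
        A₂ , β = bounded y
        -- The extra 1 covers the distance of `a n` from `x`, so that `A` bounds both `a n` and `y`.
        A = suc (A₁ ℕ.+ A₂)
        δ , 0<δ , e = divide (A ℕ.+ A) 0<ε
        M , u = p 1# 0<1
        N , v = p δ 0<δ
        K , w = q δ 0<δ
    in M ℕ.⊔ N ℕ.⊔ K , λ n le →
      let MN = ℕ.m⊔n≤o⇒m≤o (M ℕ.⊔ N) K le
          a≤A = Within-≤ (Within-resp (solve 2 (λ a x → x :+ (a :- x) := a) refl (a n) x) refl
                  (Within-+ α (u n (ℕ.m⊔n≤o⇒m≤o M N MN))))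
                (≤-resp (nat-+ A₁ 1) refl (nat-mono-≤ (ℕ.≤-trans (ℕ.≤-reflexive (ℕ.+-comm A₁ 1))
                    (ℕ.s≤s (ℕ.m≤m+n A₁ A₂)))))
          y≤A = Within-≤ β (nat-mono-≤ (ℕ.m≤n⇒m≤1+n (ℕ.m≤n+m A₂ A₁)))
      in Within-resp
        (solve 4 (λ a b x y → a :* (b :- y) :+ y :* (a :- x) := a :* b :- x :* y) refl
            (a n) (b n) x y)
        (trans (solve 2 (λ A d → A :* d :+ A :* d := (A :+ A) :* d) refl (nat A) δ)
            (trans (*-congʳ (sym (nat-+ A A))) e))
        (Within-+ (Within-* a≤A (w n (ℕ.m⊔n≤o⇒n≤o (M ℕ.⊔ N) K le)))
                  (Within-* y≤A (v n (ℕ.m⊔n≤o⇒n≤o M N MN))))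

  S : ℕ → (ℕ → Carrier) → Carrier
  S n f = sum {n} (f ∘ toℕ)

  S-cong : ∀ n {f g} → (∀ i → f i ≈ g i) → S n f ≈ S n g
  S-cong n h = sum-cong-≋ {n} (h ∘ toℕ)

  S-suc : ∀ n f → S (suc n) f ≈ S n f + f n
  S-suc zero f = +-comm (f 0) 0#
  S-suc (suc n) f = trans (+-congˡ (S-suc n (f ∘ suc)))
    (solve 3 (λ a b c → a :+ (b :+ c) := a :+ b :+ c) refl (f 0) (S n (f ∘ suc)) (f (suc n)))

  S-nonneg : ∀ n {f} → (∀ i → 0# ≤ f i) → 0# ≤ S n f
  S-nonneg zero h = ≤-refl
  S-nonneg (suc n) h = +-nonneg (h 0) (S-nonneg n (h ∘ suc))

  S-mono : ∀ {m n f} → (∀ i → 0# ≤ f i) → m ℕ.≤ n → S m f ≤ S n f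
  S-mono {n = n} h ℕ.z≤n = S-nonneg n h
  S-mono h (ℕ.s≤s p) = +-mono-≤ ≤-refl (S-mono (h ∘ suc) p)

  -- The Cauchy product coefficient and the sum of the first n coefficients
  -- (the sum of f i * g j over the triangle i + j < n).
  conv : ℕ → (f g : ℕ → Carrier) → Carrier
  conv zero    f g = f 0 * g 0
  conv (suc n) f g = f 0 * g (suc n) + conv n (f ∘ suc) g

  T : ℕ → (f g : ℕ → Carrier) → Carrier
  T zero    f g = 0#
  T (suc n) f g = f 0 * S (suc n) g + T n (f ∘ suc) g

  conv-cong : ∀ n {f f′ g g′} → (∀ i → f i ≈ f′ i) → (∀ i → g i ≈ g′ i) → conv n f g ≈ conv n f′ g′
  conv-cong zero p q = *-cong (p 0) (q 0)
  conv-cong (suc n) p q = +-cong (*-cong (p 0) (q (suc n))) (conv-cong n (p ∘ suc) q)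

  conv-suc : ∀ n f g → conv (suc n) f g ≈ conv n f (g ∘ suc) + f (suc n) * g 0
  conv-suc zero f g = refl
  conv-suc (suc n) f g = trans (+-congˡ (conv-suc n (f ∘ suc) g))
    (solve 3 (λ a b c → a :+ (b :+ c) := a :+ b :+ c) refl (f 0 * g (suc (suc n)))
        (conv n (f ∘ suc) (g ∘ suc)) (f (suc (suc n)) * g 0))

  conv-scaleˡ : ∀ n x f g → conv n (λ i → x * f i) g ≈ x * conv n f g
  conv-scaleˡ zero x f g = *-assoc x (f 0) (g 0)
  conv-scaleˡ (suc n) x f g = trans (+-cong (*-assoc x (f 0) (g (suc n)))
      (conv-scaleˡ n x (f ∘ suc) g))
    (sym (distribˡ x (f 0 * g (suc n)) (conv n (f ∘ suc) g)))

  conv-scaleʳ : ∀ n x f g → conv n f (λ i → x * g i) ≈ x * conv n f g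
  conv-scaleʳ zero x f g = solve 3 (λ x f g → f :* (x :* g) := x :* (f :* g)) refl x (f 0) (g 0)
  conv-scaleʳ (suc n) x f g = trans (+-congˡ (conv-scaleʳ n x (f ∘ suc) g))
    (solve 4 (λ x f g c → f :* (x :* g) :+ x :* c := x :* (f :* g :+ c)) refl x (f 0) (g (suc n))
        (conv n (f ∘ suc) g))

  -- Leibniz rule for the operator multiplying the i-th coefficient by i.
  conv-weight : ∀ n a f g →
    nat (a ℕ.+ n) * conv n f g ≈ conv n (λ i → nat (a ℕ.+ i) * f i) g + conv n f (λ j → nat j * g j)
  conv-weight zero a f g = solve 3 (λ a f g → a :* (f :* g) :=
      a :* f :* g :+ f :* (con (+ 0) :* g)) refl (nat (a ℕ.+ 0)) (f 0) (g 0)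
  conv-weight (suc n) a f g = begin
    nat (a ℕ.+ suc n) * (f 0 * g (suc n) + c)
      ≈⟨ distribˡ (nat (a ℕ.+ suc n)) (f 0 * g (suc n)) c ⟩
    nat (a ℕ.+ suc n) * (f 0 * g (suc n)) + nat (a ℕ.+ suc n) * c
      ≈⟨ +-cong (*-congʳ (nat-+ a (suc n))) (trans (*-congʳ (reflexive (≡.cong nat (ℕ.+-suc a n))))
          (conv-weight n (suc a) (f ∘ suc) g)) ⟩
    (nat a + nat (suc n)) * (f 0 * g (suc n)) + (conv n (λ i → nat (suc a ℕ.+ i) * f (suc i)) g + d)
      ≈⟨ +-congˡ (+-congʳ (conv-cong n (λ i → *-congʳ
          (reflexive (≡.cong nat (≡.sym (ℕ.+-suc a i))))) (λ _ → refl))) ⟩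
    (nat a + nat (suc n)) * (f 0 * g (suc n)) + (e + d)
      ≈⟨ solve 6 (λ a n f g e d → (a :+ n) :* (f :* g) :+ (e :+ d) :=
          (a :* f :* g :+ e) :+ (f :* (n :* g) :+ d)) refl (nat a) (nat (suc n)) (f 0)
              (g (suc n)) e d ⟩
    (nat a * f 0 * g (suc n) + e) + (f 0 * (nat (suc n) * g (suc n)) + d)
      ≈⟨ +-congʳ (+-congʳ (*-congʳ (*-congʳ (reflexive (≡.cong nat (≡.sym (ℕ.+-identityʳ a))))))) ⟩
    (nat (a ℕ.+ 0) * f 0 * g (suc n) + e) + (f 0 * (nat (suc n) * g (suc n)) + d) ∎
    where
    c = conv n (f ∘ suc) g
    d = conv n (f ∘ suc) (λ j → nat j * g j)
    e = conv n (λ i → nat (a ℕ.+ suc i) * f (suc i)) g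

  T-suc : ∀ n f g → T (suc n) f g ≈ T n f g + conv n f g
  T-suc zero f g = solve 2 (λ f g → f :* (g :+ con (+ 0)) :+ con (+ 0) := con (+ 0) :+ f :* g)
      refl (f 0) (g 0)
  T-suc (suc n) f g = trans (+-cong (*-congˡ (S-suc (suc n) g)) (T-suc n (f ∘ suc) g))
    (solve 5 (λ f s g t c → f :* (s :+ g) :+ (t :+ c) := (f :* s :+ t) :+ (f :* g :+ c)) refl
      (f 0) (S (suc n) g) (g (suc n)) (T n (f ∘ suc) g) (conv n (f ∘ suc) g))

  T-nonneg : ∀ n {f g} → (∀ i → 0# ≤ f i) → (∀ i → 0# ≤ g i) → 0# ≤ T n f g
  T-nonneg zero p q = ≤-refl
  T-nonneg (suc n) p q = +-nonneg (*-nonneg (p 0) (S-nonneg (suc n) q)) (T-nonneg n (p ∘ suc) q)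

  -- i < m and j < n give i + j < m + n, so the rectangle is part of the triangle and the remaining
  -- products are nonnegative.
  rectangle≤T : ∀ m n {f g} → (∀ i → 0# ≤ f i) → (∀ i → 0# ≤ g i) → S m f * S n g ≤ T (m ℕ.+ n) f g
  rectangle≤T zero n {f} {g} p q = ≤-trans (≤-reflexive (zeroˡ (S n g))) (T-nonneg n p q)
  rectangle≤T (suc m) n {f} {g} p q = ≤-trans (≤-reflexive (distribʳ (S n g) (f 0) (S m (f ∘ suc))))
    (+-mono-≤ (*-monoʳ-≤ (p 0) (S-mono q (ℕ.m≤n⇒m≤1+n (ℕ.m≤n+m n m))))
        (rectangle≤T m n (p ∘ suc) q))

  S-tail-Within : ∀ {m n g G} → (∀ j → Within (g j) (G j)) → m ℕ.≤ n →
    Within (S n g - S m g) (S n G - S m G)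
  S-tail-Within {n = zero} h ℕ.z≤n = nonneg⇒Within (≤-reflexive (sym (-‿inverseʳ 0#))) ≤-refl
  S-tail-Within {n = suc n} {g} {G} h ℕ.z≤n = Within-resp (shift g) (shift G)
    (Within-+ (h 0) (S-tail-Within {n = n} (h ∘ suc) ℕ.z≤n))
    where
    shift : ∀ g → g 0 + (S n (g ∘ suc) - 0#) ≈ S (suc n) g - 0#
    shift g = solve 2 (λ a b → a :+ (b :- con (+ 0)) := a :+ b :- con (+ 0)) refl (g 0)
        (S n (g ∘ suc))
  S-tail-Within {suc m} {suc n} {g} {G} h (ℕ.s≤s p) = Within-resp (cancel g) (cancel G)
      (S-tail-Within (h ∘ suc) p)
    where
    cancel : ∀ g → S n (g ∘ suc) - S m (g ∘ suc) ≈ S (suc n) g - S (suc m) g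
    cancel g = solve 3 (λ a b c → b :- c := a :+ b :- (a :+ c)) refl (g 0) (S n (g ∘ suc))
        (S m (g ∘ suc))

  -- For m ≤ n the triangle lies inside the rectangle, so both differences run over the same pairs
  -- (i, j), where the products are dominated termwise.
  rectangle-T-Within : ∀ {m n f g F G} → (∀ i → Within (f i) (F i)) →
    (∀ j → Within (g j) (G j)) → m ℕ.≤ n →
    Within (S m f * S n g - T m f g) (S m F * S n G - T m F G)
  rectangle-T-Within {n = n} {f} {g} {F} {G} p q ℕ.z≤n = nonneg⇒Within
    (≤-reflexive (zero-diff g)) (≤-reflexive (trans (sym (zero-diff g)) (zero-diff G)))
    where
    zero-diff : ∀ g → 0# ≈ 0# * S n g - 0#
    zero-diff g = solve 1 (λ s → con (+ 0) := con (+ 0) :* s :- con (+ 0)) refl (S n g)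
  rectangle-T-Within {suc m} {n@(suc n-1)} {f} {g} {F} {G} p q m<n@(ℕ.s≤s m≤n-1) =
      Within-resp (step f g) (step F G)
    (Within-+ (Within-* (p 0) (S-tail-Within q m<n)) (rectangle-T-Within (p ∘ suc) q
        (ℕ.m≤n⇒m≤1+n m≤n-1)))
    where
    step : ∀ f g → f 0 * (S n g - S (suc m) g) + (S m (f ∘ suc) * S n g - T m (f ∘ suc) g) ≈
                   S (suc m) f * S n g - T (suc m) f g
    step f g = solve 5 (λ a s u v t → a :* (s :- u) :+ (v :* s :- t) := (a :+ v) :* s
        :- (a :* u :+ t)) refl
      (f 0) (S n g) (S (suc m) g) (S m (f ∘ suc)) (T m (f ∘ suc) g)

  pow : Carrier → ℕ → Carrier
  pow x zero    = 1#
  pow x (suc n) = x * pow x n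

  -- term x j stands for x ^ j / j !, characterised by its recurrence.
  module Exponential
    (term : Carrier → ℕ → Carrier)
    (term-zero : ∀ x → term x 0 ≈ 1#)
    (term-suc : ∀ x j → nat (suc j) * term x (suc j) ≈ x * term x j) where

    _≈exp_ : Carrier → Carrier → Set
    y ≈exp x = Lim (λ n → S n (term x)) y

    term-cong : ∀ {x y} → x ≈ y → ∀ j → term x j ≈ term y j
    term-cong {x} {y} e zero = trans (term-zero x) (sym (term-zero y))
    term-cong {x} {y} e (suc j) = *-cancelˡ (nat-pos (suc j))
      (trans (term-suc x j) (trans (*-cong e (term-cong e j)) (sym (term-suc y j))))

    term-Within : ∀ {x y} → Within x y → ∀ j → Within (term x j) (term y j)
    term-Within {x} {y} h zero = Within-resp (sym (term-zero x)) (sym (term-zero y))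
        (nonneg⇒Within (<⇒≤ 0<1) ≤-refl)
    term-Within {x} {y} h (suc j) = Within-cancel (nat-pos (suc j))
      (Within-resp (sym (term-suc x j)) (sym (term-suc y j)) (Within-* h (term-Within h j)))

    term-nonneg : ∀ {x} → 0# ≤ x → ∀ j → 0# ≤ term x j
    term-nonneg {x} h zero = ≤-resp refl (sym (term-zero x)) (<⇒≤ 0<1)
    term-nonneg {x} h (suc j) = *-cancelˡ-≤ (nat-pos (suc j))
      (≤-resp (sym (zeroʳ (nat (suc j)))) (sym (term-suc x j)) (*-nonneg h (term-nonneg h j)))

    -- The binomial theorem without binomial coefficients. By the Leibniz rule, weighting the
    -- product by n + 1 weights one factor at a time; there `term-suc` trades the weight for a
    -- factor x or y and a shift, so the product obeys the recurrence of x + y.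
    conv-term : ∀ x y n → conv n (term x) (term y) ≈ term (x + y) n
    conv-term x y zero = trans (*-cong (term-zero x) (term-zero y))
        (trans (*-identityˡ 1#) (sym (term-zero (x + y))))
    conv-term x y (suc n) = *-cancelˡ (nat-pos (suc n)) (begin
      nat (suc n) * conv (suc n) (term x) (term y)
        ≈⟨ conv-weight (suc n) 0 (term x) (term y) ⟩
      conv (suc n) (λ i → nat i * term x i) (term y) + conv (suc n) (term x)
          (λ j → nat j * term y j)
        ≈⟨ +-cong (+-congˡ (trans (conv-cong n (term-suc x) (λ _ → refl))
            (conv-scaleˡ n x (term x) (term y))))
                  (trans (conv-suc n (term x) (λ j → nat j * term y j))
                    (+-congʳ (trans (conv-cong n (λ _ → refl) (term-suc y))
                        (conv-scaleʳ n y (term x) (term y))))) ⟩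
      (nat 0 * term x 0 * term y (suc n) + x * c) + (y * c + term x (suc n) * (nat 0 * term y 0))
        ≈⟨ solve 7 (λ a b d e x y c → (con (+ 0) :* a :* b :+ x :* c)
            :+ (y :* c :+ d :* (con (+ 0) :* e)) := (x :+ y) :* c) refl
             (term x 0) (term y (suc n)) (term x (suc n)) (term y 0) x y c ⟩
      (x + y) * c
        ≈⟨ *-congˡ (conv-term x y n) ⟩
      (x + y) * term (x + y) n
        ≈⟨ term-suc (x + y) n ⟨
      nat (suc n) * term (x + y) (suc n) ∎)
      where c = conv n (term x) (term y)

    T-term : ∀ x y n → T n (term x) (term y) ≈ S n (term (x + y))
    T-term x y zero = refl
    T-term x y (suc n) = begin
      T (suc n) (term x) (term y)                           ≈⟨ T-suc n (term x) (term y) ⟩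
      T n (term x) (term y) + conv n (term x) (term y)      ≈⟨ +-cong (T-term x y n)
          (conv-term x y n) ⟩
      S n (term (x + y)) + term (x + y) n                   ≈⟨ S-suc n (term (x + y)) ⟨
      S (suc n) (term (x + y)) ∎

    module Tail (z : ℕ) where
      t : ℕ → Carrier
      t = term (nat z)

      t≥0 : ∀ j → 0# ≤ t j
      t≥0 = term-nonneg (nat-nonneg z)

      -- The ratio of consecutive terms is z / (n + 1), at most one half once n + 1 reaches 2z.
      double-t≤ : ∀ {n} → z ℕ.+ z ℕ.≤ suc n → t (suc n) + t (suc n) ≤ t n
      double-t≤ {n} h = *-cancelˡ-≤ (nat-pos (suc n)) (≤-resp
        (trans (solve 2 (λ z t → (z :+ z) :* t := z :* t :+ z :* t) refl (nat z) (t n))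
          (trans (+-cong (sym (term-suc (nat z) n)) (sym (term-suc (nat z) n)))
              (sym (distribˡ (nat (suc n)) (t (suc n)) (t (suc n))))))
        refl (*-monoˡ-≤ (t≥0 n) (≤-resp (nat-+ z z) refl (nat-mono-≤ h))))

      -- The potential S n t + 2 t n is eventually nonincreasing.
      S-tail : ∀ m n → z ℕ.+ z ℕ.≤ n →
        S (m ℕ.+ n) t + (t (m ℕ.+ n) + t (m ℕ.+ n)) ≤ S n t + (t n + t n)
      S-tail zero n h = ≤-refl
      S-tail (suc m) n h = ≤-trans (≤-trans (≤-reflexive (+-congʳ (S-suc k t)))
        (≤-trans (+-mono-≤ (≤-refl {S k t + t k})
            (double-t≤ (ℕ.m≤n⇒m≤1+n (ℕ.≤-trans h (ℕ.m≤n+m n m)))))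
          (≤-reflexive (solve 2 (λ s t → s :+ t :+ t := s :+ (t :+ t)) refl (S k t) (t k)))))
              (S-tail m n h)
        where k = m ℕ.+ n

      t-bounded : ∀ m → t (m ℕ.+ (z ℕ.+ z)) ≤ t (z ℕ.+ z)
      t-bounded zero = ≤-refl
      t-bounded (suc m) = ≤-trans (≤-trans (≤-resp (+-identityˡ (t (suc k))) refl
          (+-mono-≤ (t≥0 (suc k)) ≤-refl))
        (double-t≤ (ℕ.m≤n⇒m≤1+n (ℕ.m≤n+m (z ℕ.+ z) m)))) (t-bounded m)
        where k = m ℕ.+ (z ℕ.+ z)

      -- Past 2z the terms stay below `t (z + z)`. One more use of the recurrence bounds t (n + 1)
      -- by z t (2z) / (n + 1), which the archimedean property makes small without any geometric
      -- estimate.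
      t-vanishes : ∀ ε → 0# < ε → ∃[ N ] z ℕ.+ z ℕ.≤ N × ∀ n → N ℕ.≤ n → t n + t n ≤ ε
      t-vanishes ε 0<ε =
        let M , h = eventually-exceeds (nat z * t (z ℕ.+ z) + nat z * t (z ℕ.+ z)) 0<ε
        in suc (M ℕ.+ (z ℕ.+ z)) , ℕ.m≤n⇒m≤1+n (ℕ.m≤n+m (z ℕ.+ z) M) , λ where
          (suc n) (ℕ.s≤s le) →
            let z+z≤n = ℕ.≤-trans (ℕ.m≤n+m (z ℕ.+ z) M) le
                bound = ≤-resp (reflexive (≡.cong t (ℕ.m∸n+n≡m z+z≤n))) refl
                    (t-bounded (n ℕ.∸ (z ℕ.+ z)))
                scaled = *-monoʳ-≤ (nat-nonneg z) bound
            in *-cancelˡ-≤ (nat-pos (suc n)) (≤-trans (≤-resp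
                (trans (+-cong (sym (term-suc (nat z) n)) (sym (term-suc (nat z) n)))
                    (sym (distribˡ (nat (suc n)) (t (suc n)) (t (suc n)))))
                refl (+-mono-≤ scaled scaled))
              (<⇒≤ (h (suc n) (ℕ.m≤n⇒m≤1+n (ℕ.≤-trans (ℕ.m≤m+n M (z ℕ.+ z)) le)))))

    -- For a bound B of x and y the defect is at most that for B and B, which is at
    -- most the part of the series of 2B between n and 2n.
    S-product : ∀ x y → Lim (λ n → S n (term x) * S n (term y) - S n (term (x + y))) 0#
    S-product x y ε 0<ε =
      let m , p = bounded x
          o , q = bounded y
          b = m ℕ.+ o
          B = nat b
          x≤B = Within-≤ p (nat-mono-≤ (ℕ.m≤m+n m o))
          y≤B = Within-≤ q (nat-mono-≤ (ℕ.m≤n+m o m))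
          open Tail (b ℕ.+ b)
          N , z≤N , small = t-vanishes ε 0<ε
          T≈S = λ k → trans (T-term B B k) (S-cong k (term-cong (sym (nat-+ b b))))
      in N , λ n le → Within-≤
        (Within-resp (trans (+-congˡ (-‿cong (T-term x y n))) (solve 1 (λ a → a := a :- con (+ 0))
            refl _)) refl
          (rectangle-T-Within (term-Within x≤B) (term-Within y≤B) (ℕ.≤-refl {n})))
        (≤-trans
          (≤-resp (+-congˡ (-‿cong (sym (T≈S n)))) refl (0≤⇒≤ (≤-resp refl
            (solve 5 (λ r s₂ s u w → (s₂ :- r) :+ (s :+ w :- (s₂ :+ u)) :+ u := w :- (r :- s)) refl
              (S n (term B) * S n (term B)) (S (n ℕ.+ n) t) (S n t)
                  (t (n ℕ.+ n) + t (n ℕ.+ n)) (t n + t n))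
            (+-nonneg (+-nonneg
              (≤⇒0≤ (≤-resp refl (T≈S (n ℕ.+ n)) (rectangle≤T n n (term-nonneg (nat-nonneg b))
                  (term-nonneg (nat-nonneg b)))))
              (≤⇒0≤ (S-tail n n (ℕ.≤-trans z≤N le))))
              (+-nonneg (t≥0 (n ℕ.+ n)) (t≥0 (n ℕ.+ n)))))))
          (small n le))

    exp-zero : ∀ {x} → x ≈ 0# → 1# ≈exp x
    -- From index 1 on: the empty partial sum lacks the constant term.
    exp-zero {x} e = Lim-eventually (1 , λ where
      (suc n) (ℕ.s≤s _) → trans (+-cong (term-zero x)
          (trans (S-cong n (λ j → *-cancelˡ (nat-pos (suc j))
        (trans (term-suc x j) (trans (*-congʳ e)
            (trans (zeroˡ (term x j)) (sym (zeroʳ (nat (suc j)))))))))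
        (sum-replicate-zero n))) (+-identityʳ 1#))

    exp-+ : ∀ {x y u v} → u ≈exp x → v ≈exp y → (u * v) ≈exp (x + y)
    exp-+ {x} {y} p q = Lim-shift (Lim-* p q) (S-product x y)

    exp-cong : ∀ {x y u v} → u ≈ v → x ≈ y → u ≈exp x → v ≈exp y
    exp-cong p e = Lim-cong (λ n → S-cong n (term-cong e)) p

    -- The partial sums for x times those for y - x tend to v, and as y - x ≥ 0 the latter dominate
    -- their first two terms 1 + (y - x).
    exp-tangent : ∀ {x y u v} → u ≈exp x → v ≈exp y → 0# < u → x ≤ y → u * (1# + (y - x)) ≤ v
    exp-tangent {x} {y} {u} {v} p q 0<u x≤y =
      -- Within distance u of u > 0 the partial sums for x are nonnegative, even if x is negative;
      -- this allows multiplying by them.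
      let M , near = p u 0<u
      in Lim-≤ (Lim-* p (Lim-eventually {λ _ → 1# + δ} (0 , λ _ _ → refl)))
        exp-+-lim
        -- Two terms must be present for 1 + δ to split off.
        (suc (suc M) , λ where
          (suc (suc n)) (ℕ.s≤s (ℕ.s≤s le)) → *-monoʳ-≤
            (0≤⇒≤ (≤-resp refl (solve 2 (λ s u → u :- :- (s :- u) := s :- con (+ 0)) refl
                (S (suc (suc n)) (term x)) u)
              (≤⇒0≤ (proj₂ (near (suc (suc n)) (ℕ.m≤n⇒m≤1+n (ℕ.m≤n⇒m≤1+n le)))))))
            (≤-resp (trans (solve 2 (λ a b → a :+ (b :+ con (+ 0)) := a :+ b) refl (term δ 0)
                (term δ 1)) (+-cong (term-zero δ) term-one)) refl
              (+-mono-≤ ≤-refl (+-mono-≤ ≤-refl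
                  (S-nonneg n (λ j → term-nonneg 0≤δ (suc (suc j))))))))
      where
      δ = y - x
      0≤δ = ≤⇒0≤ x≤y
      term-one : term δ 1 ≈ δ
      term-one = *-cancelˡ 0<1 (trans (term-suc δ 0) (trans (*-congˡ (term-zero δ)) (*-comm δ 1#)))
      x+δ≈y : x + δ ≈ y
      x+δ≈y = solve 2 (λ x y → x :+ (y :- x) := y) refl x y
      exp-+-lim : Lim (λ n → S n (term x) * S n (term δ)) v
      exp-+-lim = Lim-shift q (Lim-neg (λ n → S n (term x) * S n (term δ)) (λ n → S n (term y))
        (Lim-cong (λ n → +-congˡ (-‿cong (S-cong n (term-cong x+δ≈y)))) refl (S-product x δ)))

    exp-pow : ∀ {x u} → u ≈exp x → ∀ n → pow u n ≈exp (nat n * x)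
    exp-pow {x} p zero = exp-zero (zeroˡ x)
    exp-pow {x} p (suc n) = exp-cong refl
      (trans (solve 2 (λ x n → x :+ n :* x := (con (+ 1) :+ n) :* x) refl x (nat n))
          (*-congʳ (sym (nat-suc n)))) (exp-+ p (exp-pow p n))

    pow-pos : ∀ {x} → 0# < x → ∀ n → 0# < pow x n
    pow-pos p zero = 0<1
    pow-pos p (suc n) = *-pos p (pow-pos p n)

    -- The difference x n - nℓ lies between 0 and C, so after division by n it is below ε as soon as
    -- nε exceeds C.
    growth-rate : ∀ {u ℓ C} → 0# < u → u ≈exp ℓ →
      (y x : (n : ℕ) → .{{NonZero n}} → Carrier) → (∀ n .{{_ : NonZero n}} → y n ≈exp x n) →
      (∀ n .{{_ : NonZero n}} → pow u n ≤ y n) → (∀ n .{{_ : NonZero n}} → y n ≤ C * pow u n) →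
      ∀ ε → 0# < ε → ∃[ N ] ∀ n .{{_ : NonZero n}} → N ℕ.≤ n →
        (recip n * x n - ℓ < ε) × (ℓ - recip n * x n < ε)
    growth-rate {u} {ℓ} {C} 0<u p y x q lower upper ε 0<ε =
      let N , large = eventually-exceeds C 0<ε
      in N , λ n le →
        let i = recip n
            ℓ≈ : i * (nat n * ℓ) ≈ ℓ
            ℓ≈ = trans (sym (*-assoc i (nat n) ℓ))
                (trans (*-congʳ (trans (*-comm i (nat n)) (recip-inverse n))) (*-identityˡ ℓ))
            ε≈ : i * (nat n * ε) ≈ ε
            ε≈ = trans (sym (*-assoc i (nat n) ε))
                (trans (*-congʳ (trans (*-comm i (nat n)) (recip-inverse n))) (*-identityˡ ε))
            gap = *-pos (recip-pos n) (<⇒0< (≤-<-trans (excess n) (large n le)))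
            gap′ = *-nonneg (<⇒≤ (recip-pos n)) (≤⇒0≤ (nℓ≤x n))
        in 0<⇒< (<-resp refl (trans
             (solve 5 (λ i n ε x ℓ → i :* (n :* ε :- (x :- n :* ℓ)) := i :* (n :* ε)
                 :- (i :* x :- i :* (n :* ℓ))) refl i (nat n) ε (x n) ℓ)
             (+-cong ε≈ (-‿cong (+-congˡ (-‿cong ℓ≈))))) gap)
         , ≤-<-trans (0≤⇒≤ (≤-resp refl (trans
             (solve 4 (λ i n x ℓ → i :* (x :- n :* ℓ) := con (+ 0) :- (i :* (n :* ℓ) :- i :* x))
                 refl i (nat n) (x n) ℓ)
             (+-congˡ (-‿cong (+-congʳ ℓ≈)))) gap′)) 0<ε
      where
      -- Otherwise the tangent inequality from x n to nℓ gives y n (1 + (nℓ - x n)) ≤ uⁿ ≤ y n,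
      -- impossible for y n > 0.
      nℓ≤x : ∀ n .{{_ : NonZero n}} → nat n * ℓ ≤ x n
      nℓ≤x n x<nℓ = ≤-trans (exp-tangent (q n) (exp-pow p n) 0<y (<⇒≤ x<nℓ)) (lower n)
        (0<⇒< (<-resp refl (solve 2 (λ y d → y :* d := y :* (con (+ 1) :+ d) :- y) refl (y n)
            (nat n * ℓ - x n)) (*-pos 0<y (<⇒0< x<nℓ))))
        where 0<y = <-≤-trans (pow-pos 0<u n) (lower n)
      -- The tangent inequality from nℓ to x n gives uⁿ (1 + (x n - nℓ)) ≤ y n ≤ C uⁿ, and uⁿ
      -- cancels.
      excess : ∀ n .{{_ : NonZero n}} → x n - nat n * ℓ ≤ C
      excess n = ≤-trans (x≤1+x d)
        (*-cancelˡ-≤ (pow-pos 0<u n) (≤-trans (exp-tangent (exp-pow p n) (q n)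
            (pow-pos 0<u n) (nℓ≤x n))
          (≤-resp refl (*-comm C (pow u n)) (upper n))))
        where d = x n - nat n * ℓ

-- Words, their number, and weights peaking at a given word.

module Words (s d : ℕ) (d≤s : d ℕ.≤ s) where

  open import Data.Nat.Base using (_+_; _*_; _∸_; _≤_; _<_)
  open import Data.Nat.Properties using (_<?_; _≟_)
  open import Data.Nat.Solver using (module +-*-Solver)
  open import Data.Nat.ListAction using (sum)
  open import Data.Nat.ListAction.Properties using (sum-++)
  open import Data.Fin.Base using (_↑ˡ_; _↑ʳ_)
  open import Data.List.Base using (_++_; map; concatMap; allFin; length)
  import Data.List.Properties as List
  open import Data.List.Membership.Propositional using (find; lose)
  open import Data.List.Membership.Propositional.Properties
  open import Data.List.Relation.Unary.Any using (here)
  import Data.List.Relation.Unary.All.Properties as All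
  open import Data.List.Relation.Unary.AllPairs as AllPairs using ()
  import Data.List.Relation.Unary.AllPairs.Properties as AllPairs
  import Data.List.Relation.Unary.Unique.Propositional.Properties as Unique
  open import Relation.Binary.PropositionalEquality using (refl; sym; trans; cong; cong₂; subst)
  open import Relation.Nullary.Negation using (contradiction)

  k : ℕ
  k = s + d

  Word : ℕ → Set
  Word = Vec (Fin k)

  -- r and q are letters at consecutive blocks: r lies in the overlap of the
  -- blocks iff s ≤ r, q does iff q < d, and position r of the former block is
  -- position q of the latter iff r = s + q.
  Compatible : Fin k → Fin k → Set
  Compatible r q = s ≤ toℕ r → toℕ q < d → toℕ r ≡ s + toℕ q

  Valid : ∀ {n} → Word n → Set
  Valid = Linked Compatible

  before : Fin k → List (Fin k)
  before q with toℕ q <? d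
  ... | yes q<d = map (_↑ˡ d) (allFin s) ++ (s ↑ʳ fromℕ< q<d) ∷ []
  ... | no  _   = allFin k

  predecessors : ∀ {n} → Word n → List (Fin k)
  predecessors []      = allFin k
  predecessors (q ∷ _) = before q

  extend : ∀ {n} → Word n → List (Word (suc n))
  extend w = map (_∷ w) (predecessors w)

  words : ∀ n → List (Word n)
  words zero    = [] ∷ []
  words (suc n) = concatMap extend (words n)

  before-complete : ∀ r q → Compatible r q → r ∈ before q
  before-complete r q c with toℕ q <? d
  ... | no _ = ∈-allFin r
  ... | yes q<d with toℕ r <? s
  ... | yes r<s = ∈-++⁺ˡ (subst (_∈ map (_↑ˡ d) (allFin s))
    (Fin.toℕ-injective (trans (Fin.toℕ-↑ˡ (fromℕ< r<s) d) (Fin.toℕ-fromℕ< r<s)))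
    (∈-map⁺ (_↑ˡ d) (∈-allFin (fromℕ< r<s))))
  ... | no r≮s = ∈-++⁺ʳ (map (_↑ˡ d) (allFin s)) (here (Fin.toℕ-injective
    (trans (c (ℕ.≮⇒≥ r≮s) q<d) (sym (trans (Fin.toℕ-↑ʳ s (fromℕ< q<d))
        (cong (_+_ s) (Fin.toℕ-fromℕ< q<d)))))))

  before-sound : ∀ r q → r ∈ before q → Compatible r q
  before-sound r q r∈ s≤r q<d with toℕ q <? d
  ... | no q≮d = contradiction q<d q≮d
  ... | yes q<d′ with ∈-++⁻ (map (_↑ˡ d) (allFin s)) r∈
  ... | inj₂ (here refl) = trans (Fin.toℕ-↑ʳ s (fromℕ< q<d′)) (cong (_+_ s) (Fin.toℕ-fromℕ< q<d′))
  ... | inj₁ r∈ˡ with i , _ , refl ← ∈-map⁻ (_↑ˡ d) r∈ˡ =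
    contradiction (subst (_< s) (sym (Fin.toℕ-↑ˡ i d)) (Fin.toℕ<n i)) (ℕ.≤⇒≯ s≤r)

  before-unique : ∀ q → Unique (before q)
  before-unique q with toℕ q <? d
  ... | no _ = Unique.allFin⁺ k
  ... | yes q<d = Unique.++⁺ (Unique.map⁺ (λ {i} {j} → Fin.↑ˡ-injective d i j) (Unique.allFin⁺ s))
      ([] ∷ [])
    λ { (r∈ , here refl) → let i , _ , e = ∈-map⁻ (_↑ˡ d) r∈ in
        ℕ.<⇒≱ (subst (_< s) (sym (trans (cong toℕ e) (Fin.toℕ-↑ˡ i d))) (Fin.toℕ<n i))
          (subst (s ≤_) (sym (Fin.toℕ-↑ʳ s (fromℕ< q<d))) (ℕ.m≤m+n s _)) }

  words-complete : ∀ {n} (w : Word n) → Valid w → w ∈ words n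
  words-complete [] [] = here refl
  words-complete (r ∷ []) [-] = ∈-concatMap⁺ extend {xs = words 0}
      (here (∈-map⁺ (_∷ []) (∈-allFin r)))
  words-complete (r ∷ w@(q ∷ _)) (c ∷ v) = ∈-concatMap⁺ extend
    (lose (words-complete w v) (∈-map⁺ (_∷ w) (before-complete r q c)))

  words-sound : ∀ {n} (w : Word n) → w ∈ words n → Valid w
  words-sound [] _ = []
  words-sound (r ∷ w) rw∈ with w′ , w′∈ , rw∈′ ← find (∈-concatMap⁻ extend rw∈)
    with r′ , r′∈ , refl ← ∈-map⁻ (_∷ w′) rw∈′ = link w′ r′∈ (words-sound w′ w′∈)
    where
    link : ∀ {n} (w : Word n) {r} → r ∈ predecessors w → Valid w → Valid (r ∷ w)
    link [] _ _ = [-]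
    link (q ∷ w) {r} r∈ v = before-sound r q r∈ ∷ v

  words-unique : ∀ n → Unique (words n)
  words-unique zero = [] ∷ []
  words-unique (suc n) = Unique.concat⁺
    (All.map⁺ (All.universal (λ w → Unique.map⁺ (λ { refl → refl }) (predecessors-unique w))
        (words n)))
    (AllPairs.map⁺ (AllPairs.map disjoint (words-unique n)))
    where
    predecessors-unique : ∀ {n} (w : Word n) → Unique (predecessors w)
    predecessors-unique [] = Unique.allFin⁺ k
    predecessors-unique (q ∷ _) = before-unique q
    disjoint : ∀ {w w′ : Word n} → w ≢ w′ → ∀ {v} → ¬ (v ∈ map (_∷ w) (predecessors w) × v ∈ map
        (_∷ w′) (predecessors w′))
    disjoint {w} {w′} w≢w′ (p , q) with ∈-map⁻ (_∷ w) p | ∈-map⁻ (_∷ w′) q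
    ... | _ , _ , e | _ , _ , e′ = w≢w′ (Vec.∷-injectiveʳ (trans (sym e) e′))

  -- The indicator of `j < e`, as a number so that counting becomes summation.
  χ : ℕ → ℕ → ℕ
  χ zero    j       = 0
  χ (suc e) zero    = 1
  χ (suc e) (suc j) = χ e j

  χ-< : ∀ {e j} → j < e → χ e j ≡ 1
  χ-< {suc e} {zero} _ = refl
  χ-< {suc e} {suc j} (s≤s p) = χ-< p

  χ-≥ : ∀ {e j} → e ≤ j → χ e j ≡ 0
  χ-≥ {zero} _ = refl
  χ-≥ {suc e} {suc j} (s≤s p) = χ-≥ p

  sum-χ : ∀ e m → e ≤ m → sum (map (χ e ∘ toℕ) (allFin m)) ≡ e
  sum-χ e m e≤m = trans (cong sum (List.map-tabulate {n = m} id (χ e ∘ toℕ))) (go e m e≤m)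
    where
    zeros : ∀ m → sum (List.tabulate {n = m} (λ _ → 0)) ≡ 0
    zeros zero = refl
    zeros (suc m) = zeros m
    go : ∀ e m → e ≤ m → sum (List.tabulate {n = m} (χ e ∘ toℕ)) ≡ e
    go zero m _ = zeros m
    go (suc e) (suc m) (s≤s p) = cong suc (go e m p)

  -- Indicator of the first letter lying in the overlap with a preceding block.
  initial : ∀ {n} → Word n → ℕ
  initial []      = 0
  initial (q ∷ _) = χ d (toℕ q)

  -- A first letter in the overlap keeps s + 1 = k - (d - 1) of the k predecessors. The additive
  -- form avoids truncated subtraction.
  length-predecessors : ∀ {n} (w : Word n) → length (predecessors w) + d * initial w ≡ k + initial w
  length-predecessors [] = cong₂ _+_ (List.length-tabulate {n = k} id) (ℕ.*-zeroʳ d)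
  length-predecessors (q ∷ _) with toℕ q <? d
  ... | no q≮d rewrite χ-≥ (ℕ.≮⇒≥ q≮d) = cong₂ _+_ (List.length-tabulate {n = k} id) (ℕ.*-zeroʳ d)
  ... | yes q<d rewrite χ-< q<d | List.length-++ (map (_↑ˡ d) (allFin s)) {(s ↑ʳ fromℕ< q<d) ∷ []}
    | List.length-map (_↑ˡ d) (allFin s) | List.length-tabulate {n = s} id =
    solve 2 (λ s d → s :+ con 1 :+ d :* con 1 := s :+ d :+ con 1) refl s d
    where open +-*-Solver

  -- All d letters below d are among the first s, as d ≤ s, and the forced predecessor s + q is not
  -- below d. Independence of the word is what closes the recurrence at order two.
  initial-predecessors : ∀ {n} (w : Word n) → sum (map (χ d ∘ toℕ) (predecessors w)) ≡ d
  initial-predecessors [] = sum-χ d k (ℕ.m≤n+m d s)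
  initial-predecessors (q ∷ _) with toℕ q <? d
  ... | no q≮d = sum-χ d k (ℕ.m≤n+m d s)
  ... | yes q<d rewrite List.map-++ (χ d ∘ toℕ) (map (_↑ˡ d) (allFin s)) ((s ↑ʳ fromℕ< q<d) ∷ [])
    | sum-++ (map (χ d ∘ toℕ) (map (_↑ˡ d) (allFin s))) (χ d (toℕ (s ↑ʳ fromℕ< q<d)) ∷ [])
    | χ-≥ (ℕ.≤-trans d≤s (subst (s ≤_) (sym (Fin.toℕ-↑ʳ s (fromℕ< q<d))) (ℕ.m≤m+n s _)))
    | sym (List.map-∘ {g = χ d ∘ toℕ} {f = _↑ˡ d} (allFin s))
    | List.map-cong {g = χ d ∘ toℕ} (λ i → cong (χ d) (Fin.toℕ-↑ˡ i d)) (allFin s) =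
    trans (ℕ.+-identityʳ _) (sum-χ d s d≤s)

  count : ℕ → ℕ
  count n = length (words n)

  count-suc : ∀ n → count (suc n) + d * sum (map initial (words n)) ≡ k * count n + sum
      (map initial (words n))
  count-suc n = go (words n)
    where
    open +-*-Solver
    go : ∀ (ws : List (Word n)) → length (concatMap extend ws) + d * sum (map initial ws)
              ≡ k * length ws + sum (map initial ws)
    go [] = trans (ℕ.*-zeroʳ d) (sym (trans (ℕ.+-identityʳ (k * 0)) (ℕ.*-zeroʳ k)))
    go (w ∷ ws) rewrite List.length-++ (map (_∷ w) (predecessors w)) {concatMap extend ws}
      | List.length-map (_∷ w) (predecessors w) =
      trans (solve 5 (λ p c d i t → p :+ c :+ d :* (i :+ t) := (p :+ d :* i) :+ (c :+ d :* t)) refl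
               (length (predecessors w)) (length (concatMap extend ws)) d (initial w)
                   (sum (map initial ws)))
        (trans (cong₂ _+_ (length-predecessors w) (go ws))
          (solve 4 (λ k l i t → k :+ i :+ (k :* l :+ t) := k :* (con 1 :+ l) :+ (i :+ t)) refl k
              (length ws) (initial w) (sum (map initial ws))))

  sum-initial : ∀ n → sum (map initial (words (suc n))) ≡ d * count n
  sum-initial n = go (words n)
    where
    go : ∀ (ws : List (Word n)) → sum (map initial (concatMap extend ws)) ≡ d * length ws
    go [] = sym (ℕ.*-zeroʳ d)
    go (w ∷ ws) rewrite List.map-++ initial (map (_∷ w) (predecessors w)) (concatMap extend ws)
      | sum-++ (map initial (map (_∷ w) (predecessors w))) (map initial (concatMap extend ws))
      | sym (List.map-∘ {g = initial} {f = _∷ w} (predecessors w)) | initial-predecessors w | go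
          ws = sym (ℕ.*-suc d (length ws))

  count-recurrence : ∀ n → count (2 + n) + d * d * count n ≡ k * count (suc n) + d * count n
  count-recurrence n = trans (cong (_+_ (count (2 + n))) (trans (ℕ.*-assoc d d (count n))
      (cong (d *_) (sym (sum-initial n)))))
    (trans (count-suc (suc n)) (cong (_+_ (k * count (suc n))) (sum-initial n)))

  count-one : count 1 ≡ k
  count-one = trans (sym (ℕ.+-identityʳ (count 1)))
      (trans (cong (_+_ (count 1)) (sym (ℕ.*-zeroʳ d)))
    (trans (count-suc 0) (trans (ℕ.+-identityʳ (k * 1)) (ℕ.*-identityʳ k))))

  -- Position j of block i is coordinate s * i + j; the weights C peak, within
  -- each block, exactly at the letter of w.
  Peak : ∀ {n} → Word n → (ℕ → ℕ) → Set
  Peak {n} w C = ∀ (i : Fin n) t → t < k → t ≢ toℕ (lookup w i) →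
    C (s * toℕ i + t) < C (s * toℕ i + toℕ (lookup w i))

  private
    -- Weights for a word with one more block in front: `v` at its letter, 0 at the other
    -- coordinates that precede the next block, and `g` shifted by s from there on. `tail-weight` is
    -- what the later blocks see: `g`, overridden where the new letter lies in the overlap.
    module Glue (r v : ℕ) (g : ℕ → ℕ) where
      tail-weight : ℕ → ℕ
      tail-weight j with s + j ≟ r
      ... | yes _ = v
      ... | no  _ = g j

      glue : ℕ → ℕ
      glue j with j ≟ r
      ... | yes _ = v
      ... | no  _ with j <? s
      ... | yes _ = 0
      ... | no  _ = g (j ∸ s)

      glue-r : ∀ {j} → j ≡ r → glue j ≡ v
      glue-r {j} e with j ≟ r
      ... | yes _ = refl
      ... | no ¬e = contradiction e ¬e

      glue-low : ∀ {j} → j ≢ r → j < s → glue j ≡ 0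
      glue-low {j} j≢r j<s with j ≟ r
      ... | yes e = contradiction e j≢r
      ... | no _ with j <? s
      ... | yes _ = refl
      ... | no j≮s = contradiction j<s j≮s

      glue-tail : ∀ j → glue (s + j) ≡ tail-weight j
      glue-tail j with s + j ≟ r
      ... | yes _ = refl
      ... | no _ with s + j <? s
      ... | yes s+j<s = contradiction s+j<s (ℕ.≤⇒≯ (ℕ.m≤m+n s j))
      ... | no _ = cong g (ℕ.m+n∸m≡n s j)

      tail-other : ∀ {j} → s + j ≢ r → tail-weight j ≡ g j
      tail-other {j} ¬e with s + j ≟ r
      ... | yes e = contradiction e ¬e
      ... | no _ = refl

    glue-peak : ∀ {n} (r : Fin k) (w : Word n) v g → 0 < v →
      (∀ t → t < d → s + t ≢ toℕ r → g t < v) →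
      Peak w (Glue.tail-weight (toℕ r) v g) → Peak (r ∷ w) (Glue.glue (toℕ r) v g)
    glue-peak r w v g 0<v low peak zero t t<k t≢r = begin-strict
        glue (s * 0 + t) ≡⟨ cong (λ z → glue (z + t)) (ℕ.*-zeroʳ s) ⟩
        glue t           <⟨ go ⟩
        v                ≡⟨ glue-r refl ⟨
        glue (toℕ r)     ≡⟨ cong (λ z → glue (z + toℕ r)) (ℕ.*-zeroʳ s) ⟨
        glue (s * 0 + toℕ r) ∎
      where
      open ℕ.≤-Reasoning
      open Glue (toℕ r) v g
      go : glue t < v
      go with t <? s
      ... | yes t<s = subst (_< v) (sym (glue-low t≢r t<s)) 0<v
      ... | no t≮s with t′ , refl ← ℕ.m≤n⇒∃[o]m+o≡n (ℕ.≮⇒≥ t≮s) =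
        subst (_< v) (sym (trans (glue-tail t′) (tail-other t≢r)))
            (low t′ (ℕ.+-cancelˡ-< s t′ d t<k) t≢r)
    glue-peak r w v g 0<v low peak (suc i) t t<k t≢ =
      ≡.subst₂ _<_ (sym (shift t)) (sym (shift (toℕ (lookup w i)))) (peak i t t<k t≢)
      where
      open Glue (toℕ r) v g
      shift : ∀ t → glue (s * suc (toℕ i) + t) ≡ tail-weight (s * toℕ i + t)
      shift t = trans (cong glue (trans (cong (_+ t) (ℕ.*-suc s (toℕ i)))
          (ℕ.+-assoc s (s * toℕ i) t))) (glue-tail (s * toℕ i + t))

    -- The position raised to v lies in the first of the remaining blocks only and
    -- is not its letter.
    tail-peak : ∀ {n} r v g (q : Fin k) (w : Word n) →
      (∀ t → s + t ≡ r → t < d × t ≢ toℕ q × v < g (toℕ q)) →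
      Peak (q ∷ w) g → Peak (q ∷ w) (Glue.tail-weight r v g)
    tail-peak r v g q w raised peak zero t t<k t≢q rewrite ℕ.*-zeroʳ s =
      subst (tail-weight t <_) (sym (tail-other {toℕ q} λ e → proj₁
          (proj₂ (raised (toℕ q) e)) refl)) go
      where
      open Glue r v g
      go : tail-weight t < g (toℕ q)
      go with s + t ≟ r
      ... | yes e = proj₂ (proj₂ (raised t e))
      ... | no _ = ≡.subst₂ (λ x y → g x < g y) (cong (_+ t) (ℕ.*-zeroʳ s))
          (cong (_+ toℕ q) (ℕ.*-zeroʳ s)) (peak zero t t<k t≢q)
    tail-peak r v g q w raised peak (suc i) t t<k t≢ =
      ≡.subst₂ _<_ (sym (tail-other (later t))) (sym (tail-other (later (toℕ (lookup w i)))))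
          (peak (suc i) t t<k t≢)
      where
      open Glue r v g
      later : ∀ t → s + (s * suc (toℕ i) + t) ≢ r
      later t e = ℕ.<⇒≱ (proj₁ (raised _ e))
          (ℕ.≤-trans d≤s (ℕ.≤-trans (ℕ.≤-trans (ℕ.m≤m+n s (s * toℕ i))
              (ℕ.≤-reflexive (sym (ℕ.*-suc s (toℕ i))))) (ℕ.m≤m+n _ t)))

    same-peak : ∀ {n} (w : Word n) {f g : ℕ → ℕ} → (∀ j → f j ≡ g j) → Peak w g → Peak w f
    same-peak w {f} {g} e peak i t p q = ≡.subst₂ _<_ (sym (e _)) (sym (e _)) (peak i t p q)

  -- Built from the last block to the first. The new letter must outweigh its whole block, yet in
  -- the overlap it must not upset the peak `m` of the next one. Positivity at the first letter is
  -- carried along because other coordinates of the new block may get weight 0 while the letter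
  -- inherits `m`.
  functional : ∀ {n} (q : Fin k) (w : Word n) → Valid (q ∷ w) → ∃[ C ] 0 < C (toℕ q) ×
      Peak (q ∷ w) C
  functional q [] [-] = glue , subst (0 <_) (sym (glue-r refl)) (s≤s z≤n) ,
      glue-peak q [] 1 (λ _ → 0) (s≤s z≤n) (λ _ _ _ → s≤s z≤n) (λ ())
    where open Glue (toℕ q) 1 (λ _ → 0)
  functional r (q ∷ w) (c ∷ valid)
    with C , 0<m , peak ← functional q w valid = extend-functional
    where
    m = C (toℕ q)

    head-peak : ∀ t → t < k → t ≢ toℕ q → C t < m
    head-peak t t<k t≢q = ≡.subst₂ (λ x y → C x < C y) (cong (_+ t) (ℕ.*-zeroʳ s))
        (cong (_+ toℕ q) (ℕ.*-zeroʳ s)) (peak zero t t<k t≢q)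

    build : ∀ v g → 0 < v → (∀ t → t < d → s + t ≢ toℕ r → g t < v) →
      Peak (q ∷ w) (Glue.tail-weight (toℕ r) v g) → ∃[ C ] 0 < C (toℕ r) × Peak (r ∷ q ∷ w) C
    build v g 0<v low p = Glue.glue (toℕ r) v g , subst (0 <_) (sym (Glue.glue-r (toℕ r) v g refl))
        0<v , glue-peak r (q ∷ w) v g 0<v low p

    <d⇒<k : ∀ {t} → t < d → t < k
    <d⇒<k t<d = ℕ.<-≤-trans t<d (ℕ.m≤n+m d s)

    extend-functional : ∃[ C ] 0 < C (toℕ r) × Peak (r ∷ q ∷ w) C
    extend-functional with toℕ r <? s
    -- The letter lies before the next block, so any value above `m` will do.
    ... | yes r<s = build (suc m) C (s≤s z≤n) low
            (tail-peak (toℕ r) (suc m) C q w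
                (λ t e → contradiction r<s (ℕ.≤⇒≯ (subst (s ≤_) e (ℕ.m≤m+n s t)))) peak)
      where
      low : ∀ t → t < d → s + t ≢ toℕ r → C t < suc m
      low t t<d _ with t ≟ toℕ q
      ... | yes refl = ℕ.≤-refl
      ... | no t≢q = ℕ.m≤n⇒m≤1+n (head-peak t (<d⇒<k t<d) t≢q)
    ... | no r≮s with toℕ q <? d
    -- By compatibility both letters are the same coordinate, whose weight `m` can stay.
    ... | yes q<d = build m C 0<m
            (λ t t<d s+t≢r → head-peak t (<d⇒<k t<d) λ { refl → s+t≢r (sym r≡s+q) })
            (same-peak (q ∷ w) same peak)
      where
      r≡s+q : toℕ r ≡ s + toℕ q
      r≡s+q = c (ℕ.≮⇒≥ r≮s) q<d
      same : ∀ j → Glue.tail-weight (toℕ r) m C j ≡ C j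
      same j with s + j ≟ toℕ r
      ... | yes e = cong C (sym (ℕ.+-cancelˡ-≡ s j (toℕ q) (trans e r≡s+q)))
      ... | no _ = refl
    -- Doubling the weights makes room for a value just below the peak.
    ... | no q≮d = build (m + ℕ.pred m) (λ j → C j + C j) (ℕ.<-≤-trans 0<m (ℕ.m≤m+n m (ℕ.pred m)))
            (λ t t<d _ →
              let Ct<m = head-peak t (<d⇒<k t<d) (t≢q t<d)
              in ℕ.+-mono-<-≤ Ct<m (ℕ.≤-pred (subst (C t <_) (sym suc-pred-m) Ct<m)))
            (tail-peak (toℕ r) (m + ℕ.pred m) (λ j → C j + C j) q w
              (λ t e → let t<d = ℕ.+-cancelˡ-< s t d (subst (_< k) (sym e) (Fin.toℕ<n r)) in
                t<d , t≢q t<d , ℕ.+-monoʳ-< m (ℕ.≤-reflexive suc-pred-m))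
              (λ i t p q → let h = peak i t p q in ℕ.+-mono-< h h))
      where
      t≢q : ∀ {t} → t < d → t ≢ toℕ q
      t≢q t<d refl = q≮d t<d
      suc-pred-m : suc (ℕ.pred m) ≡ m
      suc-pred-m = ℕ.suc-pred m {{ℕ.>-nonZero 0<m}}

-- Vertices of the Minkowski sum correspond to valid words.

module Geometry (F : OrderedField) where

  open Ordered F
  open Relation.Binary.Reasoning.Setoid setoid

  -- The notions up to P are those of Defs, over an arbitrary ordered field.

  Point : ℕ → Set
  Point = Vector Carrier

  infix  4 _≋_
  infixl 7 _·_

  _≋_ : ∀ {K} → Point K → Point K → Set
  x ≋ y = ∀ j → x j ≈ y j

  _·_ : ∀ {K} → Point K → Point K → Carrier
  c · x = sum λ j → c j * x j

  basis : ∀ {K} → Fin K → Point K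
  basis i j = if does (i Fin.≟ j) then 1# else 0#

  conv : ∀ {K} → Pred (Point K) 0ℓ → Pred (Point K) 0ℓ
  conv {K} A x =
    ∃[ m ] Σ (Fin m → Point K) λ p → Σ (Fin m → Carrier) λ t →
      (∀ i → A (p i)) × (∀ i → 0# ≤ t i) × sum t ≈ 1# ×
      x ≋ (λ j → sum λ i → t i * p i j)

  minkowskiSum : ∀ {K n} → (Fin n → Pred (Point K) 0ℓ) → Pred (Point K) 0ℓ
  minkowskiSum {K} {n} Q x =
    Σ (Fin n → Point K) λ y → (∀ i → Q i (y i)) × x ≋ (λ j → sum λ i → y i j)

  IsVertex : ∀ {K} → Pred (Point K) 0ℓ → Pred (Point K) 0ℓ
  IsVertex {K} A v = A v × Σ (Point K) λ c →
    ∀ x → A x → (c · x ≤ c · v) × (c · x ≈ c · v → x ≋ v)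

  HasVertexCount : ∀ {K} → Pred (Point K) 0ℓ → ℕ → Set
  HasVertexCount A b = Σ (Fin b → ∃ (IsVertex A))
    (Bijective _≡_ λ v w → proj₁ v ≋ proj₁ w)

  Δ : ∀ {K} → Pred (Fin K) 0ℓ → Pred (Point K) 0ℓ
  Δ Λ = conv λ p → ∃[ j ] Λ j × p ≋ basis j

  P : (n k s : ℕ) → Pred (Point (D.dim n k s)) 0ℓ
  P n k s = minkowskiSum λ i → Δ (D.block n k s i)

  ≋-sym : ∀ {K} {x y : Point K} → x ≋ y → y ≋ x
  ≋-sym h j = sym (h j)

  ≋-trans : ∀ {K} {x y z : Point K} → x ≋ y → y ≋ z → x ≋ z
  ≋-trans p q j = trans (p j) (q j)

  sum-cong : ∀ {n} {f g : Vector Carrier n} → (∀ i → f i ≈ g i) → sum f ≈ sum g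
  sum-cong {n} = sum-cong-≋ {n}

  ·-cong : ∀ {K} (c : Point K) {x y : Point K} → x ≋ y → c · x ≈ c · y
  ·-cong c h = sum-cong λ j → *-congˡ (h j)

  ·-basis : ∀ {K} (c : Point K) i → c · basis i ≈ c i
  ·-basis {suc K} c zero = trans
    (+-cong (trans (*-comm (c zero) 1#) (*-identityˡ (c zero)))
      (trans (sum-cong λ j → zeroʳ (c (suc j))) (sum-replicate-zero K)))
    (+-identityʳ (c zero))
  ·-basis {suc K} c (suc i) = trans (+-cong (zeroʳ (c zero)) (·-basis (c ∘ suc) i))
      (+-identityˡ (c (suc i)))

  ·-sum : ∀ {K n} (c : Point K) (y : Fin n → Point K) → c · (λ j → sum λ i → y i j) ≈ sum
      λ i → c · y i
  ·-sum c y = trans (sum-cong λ j → *-distribˡ-sum (c j) (λ i → y i j))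
      (∑-comm (λ j i → c j * y i j))

  ·-scale : ∀ {K} (c : Point K) t (p : Point K) → c · (λ j → t * p j) ≈ t * (c · p)
  ·-scale c t p = trans (sum-cong λ j → solve 3 (λ c t p → c :* (t :* p) := t :* (c :* p)) refl
      (c j) t (p j))
    (sym (*-distribˡ-sum t (λ j → c j * p j)))

  sum-scaleʳ : ∀ {n} (t : Vector Carrier n) x → sum t ≈ 1# → (sum λ i → t i * x) ≈ x
  sum-scaleʳ t x e = trans (sum-cong λ i → *-comm (t i) x)
    (trans (sym (*-distribˡ-sum x t)) (trans (*-congˡ e) (trans (*-comm x 1#) (*-identityˡ x))))

  ·-conv : ∀ {K m} (c : Point K) (p : Fin m → Point K) (t : Vector Carrier m) {x} → x ≋
      (λ j → sum λ i → t i * p i j) →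
    c · x ≈ sum λ i → t i * (c · p i)
  ·-conv c p t h = trans (·-cong c h) (trans (·-sum c (λ i j → t i * p i j))
      (sum-cong λ i → ·-scale c (t i) (p i)))

  basis∈Δ : ∀ {K} {Λ : Pred (Fin K) 0ℓ} {j} → Λ j → Δ Λ (basis j)
  basis∈Δ {j = j} j∈Λ = 1 , (λ _ → basis j) , (λ _ → 1#) , (λ _ → j , j∈Λ , λ _ → refl) ,
    (λ _ → <⇒≤ 0<1) , +-identityʳ 1# , λ i → sym (trans (+-identityʳ (1# * basis j i))
        (*-identityˡ (basis j i)))

  Δ-bound : ∀ {K} {Λ : Pred (Fin K) 0ℓ} (c : Point K) M → (∀ j → Λ j → c j ≤ M) → ∀ {y} →
      Δ Λ y → c · y ≤ M
  Δ-bound c M h (m , p , t , p∈ , t≥0 , ∑t≈1 , y≋) = ≤-resp (sym (·-conv c p t y≋))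
      (sum-scaleʳ t M ∑t≈1)
    (sum-mono λ l →
      let j , j∈Λ , e = p∈ l
      in *-monoʳ-≤ (t≥0 l) (≤-resp (sym (trans (·-cong c e) (·-basis c j))) refl (h j j∈Λ)))

  -- Equality holds in every term of the convex combination. A point other than `basis f` then has
  -- coefficient t ≤ t (c f - c j) = 0; the gap of 1, available because the weights are natural
  -- numbers, makes division unnecessary.
  Δ-support : ∀ {K} {Λ : Pred (Fin K) 0ℓ} (c : Point K) f → (∀ j → Λ j → j ≢ f → 1# + c j ≤ c f) →
    ∀ {y} → Δ Λ y → c f ≤ c · y → y ≋ basis f
  Δ-support c f h {y} (m , p , t , p∈ , t≥0 , ∑t≈1 , y≋) max = ≋-trans y≋ λ i →
    trans (sum-cong λ l → same l i) (sum-scaleʳ t (basis f i) ∑t≈1)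
    where
    c≤ : ∀ j → _ → c j ≤ c f
    c≤ j j∈Λ with j Fin.≟ f
    ... | yes ≡.refl = ≤-refl
    ... | no j≢f = ≤-trans (x≤1+x (c j)) (h j j∈Λ j≢f)
    value : ∀ l → c · p l ≈ c (proj₁ (p∈ l))
    value l = let j , _ , e = p∈ l in trans (·-cong c e) (·-basis c j)
    tight-l : ∀ l → t l * c (proj₁ (p∈ l)) ≈ t l * c f
    tight-l = sum-squeeze (λ l → *-monoʳ-≤ (t≥0 l) (c≤ _ (proj₁ (proj₂ (p∈ l)))))
      (≤-resp (sym (sum-scaleʳ t (c f) ∑t≈1))
          (trans (·-conv c p t y≋) (sum-cong λ l → *-congˡ (value l))) max)
    same : ∀ l i → t l * p l i ≈ t l * basis f i
    same l i with p∈ l | tight-l l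
    ... | j , j∈Λ , e | q with j Fin.≟ f
    ... | yes ≡.refl = *-congˡ (e i)
    ... | no j≢f = trans (*-congʳ t≈0) (trans (zeroˡ (p l i))
        (sym (trans (*-congʳ t≈0) (zeroˡ (basis f i)))))
      where
      t≈0 : t l ≈ 0#
      t≈0 = ≤-antisym (≤-resp (trans (*-comm (t l) 1#) (*-identityˡ (t l)))
          (trans (solve 3 (λ t a b → t :* (b :- a) := t :* b :- t :* a) refl (t l) (c j) (c f))
            (trans (+-congʳ (sym q)) (-‿inverseʳ (t l * c j))))
          (*-monoʳ-≤ (t≥0 l) (0≤⇒≤ (≤-resp refl
              (solve 2 (λ a b → b :- (con (+ 1) :+ a) := b :- a :- con (+ 1)) refl (c j) (c f))
                  (≤⇒0≤ (h j j∈Λ j≢f))))))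
        (t≥0 l)

  -- Finiteness of the range lets the double-negated choices be made in all blocks at once.
  ¬¬-∀ : ∀ {n} {A : Fin n → Set} → (∀ i → ¬ ¬ A i) → ¬ ¬ (∀ i → A i)
  ¬¬-∀ {zero} h ¬p = ¬p λ ()
  ¬¬-∀ {suc n} h ¬p = h zero λ a → ¬¬-∀ (h ∘ suc) λ as → ¬p λ { zero → a ; (suc i) → as i }

  -- Taking the first maximiser makes the choices in two consecutive blocks agree
  -- when both lie in the overlap.
  argmax : ∀ {m} .{{_ : NonZero m}} (g : Fin m → Carrier) →
    ¬ ¬ (∃[ r ] (∀ i → g i ≤ g r) × (∀ i → i Fin.< r → g i < g r))
  argmax {suc zero} g ¬p = ¬p (zero , (λ { zero → ≤-refl }) , λ _ ())
  argmax {suc (suc m)} g ¬p = argmax (g ∘ suc) λ (r , max , first) → ¬¬-excluded-middle λ where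
    (yes lt) → ¬p (suc r , (λ { zero → <⇒≤ lt ; (suc i) → max i })
                         , λ { zero _ → lt ; (suc i) (s≤s p) → first i p })
    (no ¬lt) → ¬p (zero , (λ { zero → ≤-refl ; (suc i) → ≤-trans (max i) ¬lt }) , λ _ ())

  lookup-injective : ∀ {A : Set} {xs : List A} → Unique xs → ∀ i j → List.lookup xs i ≡
      List.lookup xs j → i ≡ j
  lookup-injective (_ ∷ _) zero zero _ = ≡.refl
  lookup-injective {xs = x ∷ xs} (x∉ ∷ _) zero (suc j) e =
      ⊥-elim (All.lookup x∉ (∈-lookup {xs = xs} j) e)
  lookup-injective {xs = x ∷ xs} (x∉ ∷ _) (suc i) zero e =
      ⊥-elim (All.lookup x∉ (∈-lookup {xs = xs} i) (≡.sym e))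
  lookup-injective (_ ∷ u) (suc i) (suc j) e = ≡.cong suc (lookup-injective u i j e)

  module _ (s d : ℕ) (d≤s : d ℕ.≤ s) .{{_ : NonZero (s ℕ.+ d)}} where

    open Words s d d≤s

    module _ (n-1 : ℕ) where
      private
        n K : ℕ
        n = suc n-1
        K = D.dim n k s

        ι< : ∀ (i : Fin n) (r : Fin k) → s ℕ.* toℕ i ℕ.+ toℕ r ℕ.< K
        ι< i r = ℕ.+-mono-≤-< (ℕ.*-monoʳ-≤ s (ℕ.≤-pred (Fin.toℕ<n i))) (Fin.toℕ<n r)

      coord : Fin n → Fin k → Fin K
      coord i r = fromℕ< (ι< i r)

      toℕ-coord : ∀ i r → toℕ (coord i r) ≡ s ℕ.* toℕ i ℕ.+ toℕ r
      toℕ-coord i r = Fin.toℕ-fromℕ< (ι< i r)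

      coord∈block : ∀ i r → D.block n k s i (coord i r)
      coord∈block i r rewrite toℕ-coord i r = ℕ.m≤m+n (s ℕ.* toℕ i) (toℕ r) , ℕ.+-monoʳ-<
          (s ℕ.* toℕ i) (Fin.toℕ<n r)

      block⇒coord : ∀ i j → D.block n k s i j → ∃[ r ] j ≡ coord i r
      block⇒coord i j (lo , hi) with t , e ← ℕ.m≤n⇒∃[o]m+o≡n lo =
        fromℕ< t<k , Fin.toℕ-injective (≡.trans (≡.sym e)
            (≡.sym (≡.trans (toℕ-coord i (fromℕ< t<k))
                (≡.cong (ℕ._+_ (s ℕ.* toℕ i)) (Fin.toℕ-fromℕ< t<k)))))
        where
        t<k : t ℕ.< k
        t<k = ℕ.+-cancelˡ-< (s ℕ.* toℕ i) t k (≡.subst (ℕ._< s ℕ.* toℕ i ℕ.+ k) (≡.sym e) hi)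

      vertex : Word n → Point K
      vertex w j = sum λ i → basis (coord i (lookup w i)) j

      vertex∈P : ∀ w → P n k s (vertex w)
      vertex∈P w = (λ i → basis (coord i (lookup w i))) ,
          (λ i → basis∈Δ (coord∈block i (lookup w i))) , λ _ → refl

      ·-vertex : ∀ c w → c · vertex w ≈ sum λ i → c (coord i (lookup w i))
      ·-vertex c w = trans (·-sum c (λ i → basis (coord i (lookup w i))))
          (sum-cong λ i → ·-basis c (coord i (lookup w i)))

      P-bound : ∀ c w → (∀ i j → D.block n k s i j → c j ≤ c (coord i (lookup w i))) → ∀ x →
          P n k s x → c · x ≤ c · vertex w
      P-bound c w h x (y , y∈ , x≋) = ≤-resp (sym (trans (·-cong c x≋) (·-sum c y)))
          (sym (·-vertex c w))
        (sum-mono λ i → Δ-bound c (c (coord i (lookup w i))) (h i) (y∈ i))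

      private
        peaked : ∀ (w : Word n) → Valid w → ∃ (Peak w)
        peaked (r ∷ v) valid = let C , _ , peak = functional r v valid in C , peak

      module Functional (w : Word n) (valid : Valid w) where
        C : ℕ → ℕ
        C = proj₁ (peaked w valid)

        peak : Peak w C
        peak = proj₂ (peaked w valid)

        c : Point K
        c j = nat (C (toℕ j))

        peak-coord : ∀ i r → r ≢ lookup w i → C (toℕ (coord i r)) ℕ.< C (toℕ (coord i (lookup w i)))
        peak-coord i r r≢ = ≡.subst₂ (λ a b → C a ℕ.< C b) (≡.sym (toℕ-coord i r))
            (≡.sym (toℕ-coord i (lookup w i)))
          (peak i (toℕ r) (Fin.toℕ<n r) (r≢ ∘ Fin.toℕ-injective))

        c-peak : ∀ i j → D.block n k s i j → j ≢ coord i (lookup w i) → 1# + c j ≤ c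
            (coord i (lookup w i))
        c-peak i j j∈ j≢ with r , ≡.refl ← block⇒coord i j j∈ =
          ≤-resp (nat-suc (C (toℕ (coord i r)))) refl
              (nat-mono-≤ (peak-coord i r (λ e → j≢ (≡.cong (coord i) e))))

        c-max : ∀ i j → D.block n k s i j → c j ≤ c (coord i (lookup w i))
        c-max i j j∈ with j Fin.≟ coord i (lookup w i)
        ... | yes ≡.refl = ≤-refl
        ... | no j≢ = ≤-trans (x≤1+x (c j)) (c-peak i j j∈ j≢)

        -- A point attaining the maximum does so in each block separately, and there the peak leaves
        -- only one basis vector.
        vertex-isVertex : IsVertex (P n k s) (vertex w)
        vertex-isVertex = vertex∈P w , c , λ x x∈P@(y , y∈ , x≋) → P-bound c w c-max x x∈P , λ e →
          let tight-i = sum-squeeze (λ i → Δ-bound c (c (coord i (lookup w i))) (c-max i) (y∈ i))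
                          (≤-reflexive (trans (sym (·-vertex c w))
                              (trans (sym e) (trans (·-cong c x≋) (·-sum c y)))))
          in ≋-trans x≋ λ j → sum-cong λ i → Δ-support c (coord i (lookup w i)) (c-peak i) (y∈ i)
              (≤-reflexive (sym (tight-i i))) j

        -- The functional peaking at `w` takes the same value at both points, so `w′` reaches the
        -- peak in every block too.
        vertex-injective : ∀ w′ → vertex w′ ≋ vertex w → w′ ≡ w
        vertex-injective w′ e = ≡.trans (≡.sym (Vec.tabulate∘lookup w′))
            (≡.trans (Vec.tabulate-cong same) (Vec.tabulate∘lookup w))
          where
          tight-i : ∀ i → c (coord i (lookup w′ i)) ≈ c (coord i (lookup w i))
          tight-i = sum-squeeze (λ i → c-max i (coord i (lookup w′ i))
              (coord∈block i (lookup w′ i)))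
            (≤-reflexive (trans (sym (·-vertex c w)) (trans (·-cong c (≋-sym e)) (·-vertex c w′))))
          same : ∀ i → lookup w′ i ≡ lookup w i
          same i with lookup w′ i Fin.≟ lookup w i
          ... | yes e′ = e′
          ... | no ≢ = ⊥-elim (ℕ.<⇒≢ (peak-coord i (lookup w′ i) ≢) (nat-injective (tight-i i)))

      tabulate-valid : ∀ {n} (f : Fin n → Fin k) →
        (∀ i j → toℕ j ≡ suc (toℕ i) → Compatible (f i) (f j)) → Valid (tabulate f)
      tabulate-valid {zero} f h = []
      tabulate-valid {suc zero} f h = [-]
      tabulate-valid {suc (suc n)} f h = h zero (suc zero) ≡.refl ∷ tabulate-valid (f ∘ suc) λ i j
          e → h (suc i) (suc j) (≡.cong suc e)

      -- At the point given by maximising letters, `c` is as large as anywhere on the polytope, and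
      -- a functional exposing `v` has no other maximiser.
      vertex⇒word : ∀ {v} → IsVertex (P n k s) v → ¬ ¬ (∃[ w ] Valid w × v ≋ vertex w)
      vertex⇒word {v} (v∈P , c , max) ¬p = ¬¬-∀ (λ i → argmax (c ∘ coord i)) λ best →
          ¬p (found best)
        where
        found : (∀ i → ∃[ r ] (∀ t → c (coord i t) ≤ c (coord i r)) ×
            (∀ t → t Fin.< r → c (coord i t) < c (coord i r))) →
          ∃[ w ] Valid w × v ≋ vertex w
        found best = w , tabulate-valid f compatible , ≋-sym (proj₂ (max (vertex w) (vertex∈P w))
          (≤-antisym (proj₁ (max (vertex w) (vertex∈P w))) (P-bound c w c-max v v∈P)))
          where
          f : Fin n → Fin k
          f i = proj₁ (best i)
          w = tabulate f
          c-max : ∀ i j → D.block n k s i j → c j ≤ c (coord i (lookup w i))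
          c-max i j j∈ with r , ≡.refl ← block⇒coord i j j∈ =
            ≡.subst (λ t → c (coord i r) ≤ c (coord i t)) (≡.sym (Vec.lookup∘tabulate f i))
                (proj₁ (proj₂ (best i)) r)
          -- `q′` is the letter of block j denoting the coordinate of `f i`, and `r′` the letter of
          -- block i denoting that of `f j`. If these coordinates differ, the block that chose the
          -- later one finds it strictly better than the earlier, against maximality in the other
          -- block.
          compatible : ∀ i j → toℕ j ≡ suc (toℕ i) → Compatible (f i) (f j)
          compatible i j j≡1+i s≤r q<d with u , s+u≡r ← ℕ.m≤n⇒∃[o]m+o≡n s≤r =
              go (ℕ.<-cmp (toℕ (f i)) (s ℕ.+ toℕ (f j)))
            where
            u<d : u ℕ.< d
            u<d = ℕ.+-cancelˡ-< s u d (≡.subst (ℕ._< k) (≡.sym s+u≡r) (Fin.toℕ<n (f i)))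
            u<k : u ℕ.< k
            u<k = ℕ.<-≤-trans u<d (ℕ.m≤n+m d s)
            s+q<k : s ℕ.+ toℕ (f j) ℕ.< k
            s+q<k = ℕ.+-monoʳ-< s q<d
            shift : ∀ (r q : Fin k) → toℕ r ≡ s ℕ.+ toℕ q → coord i r ≡ coord j q
            shift r q e = Fin.toℕ-injective
                (≡.trans (toℕ-coord i r) (≡.trans (≡.trans (≡.cong (ℕ._+_ (s ℕ.* toℕ i)) e)
              (≡.trans (≡.sym (ℕ.+-assoc (s ℕ.* toℕ i) s (toℕ q))) (≡.cong (ℕ._+ toℕ q)
                (≡.trans (ℕ.+-comm (s ℕ.* toℕ i) s) (≡.trans (≡.sym (ℕ.*-suc s (toℕ i)))
                    (≡.cong (s ℕ.*_) (≡.sym j≡1+i)))))))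
              (≡.sym (toℕ-coord j q))))
            r′ q′ : Fin k
            r′ = fromℕ< s+q<k
            q′ = fromℕ< u<k
            r≡ : coord i (f i) ≡ coord j q′
            r≡ = shift (f i) q′ (≡.trans (≡.sym s+u≡r)
                (≡.cong (ℕ._+_ s) (≡.sym (Fin.toℕ-fromℕ< u<k))))
            q≡ : coord i r′ ≡ coord j (f j)
            q≡ = shift r′ (f j) (Fin.toℕ-fromℕ< s+q<k)
            go : _ → toℕ (f i) ≡ s ℕ.+ toℕ (f j)
            go (tri≈ _ e _) = e
            go (tri< lt _ _) = ⊥-elim (proj₁ (proj₂ (best i)) r′
                (≡.subst₂ (λ a b → c a < c b) (≡.sym r≡) (≡.sym q≡)
              (proj₂ (proj₂ (best j)) q′ (≡.subst (ℕ._< toℕ (f j)) (≡.sym (Fin.toℕ-fromℕ< u<k))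
                (ℕ.+-cancelˡ-< s u (toℕ (f j)) (≡.subst (ℕ._< s ℕ.+ toℕ (f j))
                    (≡.sym s+u≡r) lt))))))
            go (tri> _ _ gt) = ⊥-elim (proj₁ (proj₂ (best j)) q′ (≡.subst₂ (λ a b → c a < c b) q≡ r≡
              (proj₂ (proj₂ (best i)) r′ (≡.subst (ℕ._< toℕ (f i))
                  (≡.sym (Fin.toℕ-fromℕ< s+q<k)) gt))))

      -- Injections in both directions. A vertex yields its word only under double negation, which
      -- the decidable inequality between `b` and the count absorbs.
      vertexCount : ∀ b → HasVertexCount (P n k s) b → b ≡ count n
      vertexCount b (vs , injective , surjective) = ℕ.≤-antisym
        (decidable-stable (b ℕ.≤? count n) λ ¬p → ¬¬-∀ (λ i → vertex⇒word (proj₂ (vs i)))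
            (¬p ∘ b≤count))
        (Fin.injective⇒≤ {f = number} number-injective)
        where
        word : Fin (count n) → Word n
        word = List.lookup (words n)
        module At i = Functional (word i) (words-sound (word i) (∈-lookup {xs = words n} i))
        number : Fin (count n) → Fin b
        number i = proj₁ (surjective (vertex (word i) , At.vertex-isVertex i))
        number-spec : ∀ i → proj₁ (vs (number i)) ≋ vertex (word i)
        number-spec i = proj₂ (surjective (vertex (word i) , At.vertex-isVertex i)) ≡.refl
        number-injective : ∀ {i j} → number i ≡ number j → i ≡ j
        number-injective {i} {j} e = lookup-injective (words-unique n) i j
            (At.vertex-injective j (word i)
          (≋-trans (≋-sym (number-spec i)) (≡.subst (λ m → proj₁ (vs m) ≋ vertex (word j))
              (≡.sym e) (number-spec j))))
        b≤count : (∀ i → ∃[ w ] Valid w × proj₁ (vs i) ≋ vertex w) → b ℕ.≤ count n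
        b≤count found = Fin.injective⇒≤ {f = position} λ {i} {j} e → injective
          (≋-trans (proj₂ (proj₂ (found i)))
              (≋-trans (λ l → reflexive (≡.cong (λ w → vertex w l) (same e)))
                  (≋-sym (proj₂ (proj₂ (found j))))))
          where
          member : ∀ i → proj₁ (found i) ∈ words n
          member i = words-complete (proj₁ (found i)) (proj₁ (proj₂ (found i)))
          position : Fin b → Fin (count n)
          position i = index (member i)
          same : ∀ {i j} → position i ≡ position j → proj₁ (found i) ≡ proj₁ (found j)
          same {i} {j} e = ≡.trans (lookup-index (member i))
              (≡.trans (≡.cong word e) (≡.sym (lookup-index (member j))))

-- Growth of the number of words and the limit of the logarithms.

module Growth (F : OrderedField) where

  open Ordered F
  open Exp F
  module G = Geometry F
  open Relation.Binary.Reasoning.Setoid setoid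

  recip-* : ∀ m n .{{_ : NonZero m}} .{{_ : NonZero n}} .{{_ : NonZero (m ℕ.* n)}} → nat m * recip
      (m ℕ.* n) ≈ recip n
  recip-* m n = *-cancelˡ (nat-pos n) (begin
    nat n * (nat m * recip (m ℕ.* n)) ≈⟨ solve 3 (λ n m i → n :* (m :* i) := m :* n :* i) refl
        (nat n) (nat m) (recip (m ℕ.* n)) ⟩
    nat m * nat n * recip (m ℕ.* n)   ≈⟨ *-congʳ (sym (nat-* m n)) ⟩
    nat (m ℕ.* n) * recip (m ℕ.* n)   ≈⟨ recip-inverse (m ℕ.* n) ⟩
    1#                                ≈⟨ recip-inverse n ⟨
    nat n * recip n                   ∎)

  power-term-suc : ∀ x y j →
    nat (suc j) * (x * y * recip (suc j !) {{suc j ℕ.!≢0}}) ≈ x * (y * recip (j !) {{j ℕ.!≢0}})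
  power-term-suc x y j = trans (solve 4 (λ n x y i → n :* (x :* y :* i) := x :* (y :* (n :* i)))
      refl
    (nat (suc j)) x y (recip (suc j !) {{suc j ℕ.!≢0}}))
    (*-congˡ (*-congˡ (recip-* (suc j) (j !) {{_}} {{j ℕ.!≢0}} {{suc j ℕ.!≢0}})))

  infix 4 _⟶_
  _⟶_ : ((n : ℕ) → .{{NonZero n}} → Carrier) → Carrier → Set
  a ⟶ ℓ = ∀ ε → 0# < ε →
    ∃[ N ] ∀ n .{{_ : NonZero n}} → N ℕ.≤ n → (a n - ℓ < ε) × (ℓ - a n < ε)

  ⟶⇒Lim : ∀ {a : ℕ → Carrier} {ℓ} → (λ n → a n) ⟶ ℓ → Lim a ℓ
  -- `suc N` excludes index 0, about which `_⟶_` says nothing.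
  ⟶⇒Lim {a} {ℓ} h ε 0<ε = let N , p = h ε 0<ε in suc N , λ where
    (suc n) (s≤s le) → let u , v = p (suc n) (ℕ.m≤n⇒m≤1+n le) in
      <⇒≤ u , ≤-resp (solve 2 (λ a l → l :- a := :- (a :- l)) refl (a (suc n)) ℓ) refl (<⇒≤ v)

  -- The equations for `r` and `L` have the shape to which the graphs of root and quotient unfold;
  -- in particular k² is `k * (k * 1#)`.
  module Asymptotics
    (s d : ℕ) (2≤d : 2 ℕ.≤ d) (d≤s : d ℕ.≤ s) (r L : Carrier) (0≤r : 0# ≤ r)
    (r*r : r * r ≈ nat (s ℕ.+ d) * (nat (s ℕ.+ d) * 1#) - nat 4 * (nat (s ℕ.+ d) - nat s) * (nat
        (s ℕ.+ d) - nat s - 1#))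
    (L-eq : L * (nat (s ℕ.+ d) - r) ≈ nat 2 * (nat (s ℕ.+ d) - nat s) * (nat (s ℕ.+ d) - nat
        s - 1#)) where

    open Words s d d≤s

    private
      -- `L` and `μ` turn out to be the two roots of x² = Kx - q, `μ` being the smaller.
      K D q μ : Carrier
      K = nat k
      D = nat d
      q = D * (D - 1#)
      μ = K - L

      K≈s+D : K ≈ nat s + D
      K≈s+D = nat-+ s d

      K-s : K - nat s ≈ D
      K-s = trans (+-congʳ K≈s+D) (solve 2 (λ s d → s :+ d :- s := d) refl (nat s) D)

      r² : r * r ≈ K * K - nat 4 * q
      r² = trans r*r (+-cong (*-congˡ (trans (*-comm K 1#) (*-identityˡ K)))
        (-‿cong (trans (*-cong (*-congˡ K-s) (+-congʳ K-s)) (*-assoc (nat 4) D (D - 1#)))))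

      L*[K-r] : L * (K - r) ≈ nat 2 * q
      L*[K-r] = trans L-eq (trans (*-cong (*-congˡ K-s) (+-congʳ K-s)) (*-assoc (nat 2) D (D - 1#)))

      0<D-1 : 0# < D - 1#
      0<D-1 = <⇒0< (<-≤-trans (nat-mono-< {1} {2} (s≤s (s≤s z≤n))) (nat-mono-≤ 2≤d))

      0<D : 0# < D
      0<D = <-≤-trans (nat-mono-< {0} {2} (s≤s z≤n)) (nat-mono-≤ 2≤d)

      0<q : 0# < q
      0<q = *-pos 0<D 0<D-1

      0<K : 0# < K
      0<K = <-≤-trans 0<D (nat-mono-≤ (ℕ.m≤n+m d s))

      1≤K : 1# ≤ K
      1≤K = nat-mono-≤ (ℕ.≤-trans (ℕ.≤-trans (s≤s z≤n) 2≤d) (ℕ.m≤n+m d s))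

      0<2 : 0# < nat 2
      0<2 = nat-pos 2

      0<4 : 0# < nat 4
      0<4 = nat-pos 4

      -- Rationalising the denominator: multiply L (K - r) = 2q by K + r, use K² - r² = 4q, and
      -- cancel 2q, which is positive because 2 ≤ d.
      2L : nat 2 * L ≈ K + r
      2L = *-cancelˡ (*-pos 0<2 0<q) (begin
        nat 2 * q * (nat 2 * L)              ≈⟨ solve 2
            (λ q l → con (+ 2) :* q :* (con (+ 2) :* l) := con (+ 4) :* q :* l) refl q L ⟩
        nat 4 * q * L                        ≈⟨ *-congʳ
            (solve 2 (λ q k → con (+ 4) :* q := k :* k :- (k :* k :- con (+ 4) :* q)) refl q K) ⟩
        (K * K - (K * K - nat 4 * q)) * L    ≈⟨ *-congʳ (+-congˡ (-‿cong (sym r²))) ⟩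
        (K * K - r * r) * L                  ≈⟨ solve 3 (λ k r l → (k :* k :- r :* r) :* l :=
            (l :* (k :- r)) :* (k :+ r)) refl K r L ⟩
        L * (K - r) * (K + r)                ≈⟨ *-congʳ L*[K-r] ⟩
        nat 2 * q * (K + r)                  ∎)

      2μ : nat 2 * μ ≈ K - r
      2μ = trans (solve 2 (λ k l → con (+ 2) :* (k :- l) := con (+ 2) :* k :- con (+ 2) :* l) refl
          K L)
        (trans (+-congˡ (-‿cong 2L)) (solve 2 (λ k r → con (+ 2) :* k :- (k :+ r) := k :- r) refl K
            r))

      L*μ : L * μ ≈ q
      L*μ = *-cancelˡ 0<4 (begin
        nat 4 * (L * μ)                ≈⟨ solve 2 (λ l m → con (+ 4) :* (l :* m) :=
            (con (+ 2) :* l) :* (con (+ 2) :* m)) refl L μ ⟩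
        (nat 2 * L) * (nat 2 * μ)      ≈⟨ *-cong 2L 2μ ⟩
        (K + r) * (K - r)              ≈⟨ solve 2 (λ k r → (k :+ r) :* (k :- r) := k :* k
            :- r :* r) refl K r ⟩
        K * K - r * r                  ≈⟨ +-congˡ (-‿cong r²) ⟩
        K * K - (K * K - nat 4 * q)    ≈⟨ solve 2 (λ q k → k :* k :- (k :* k :- con (+ 4) :* q) :=
            con (+ 4) :* q) refl q K ⟩
        nat 4 * q                      ∎)

      r≤K : r ≤ K
      r≤K K<r = <-asym (*-pos 0<4 0<q) (0<⇒< (<-resp refl (trans
        (solve 2 (λ k r → (r :- k) :* (k :+ r) := r :* r :- k :* k) refl K r)
        (trans (+-congʳ r²) (solve 2 (λ k q → k :* k :- con (+ 4) :* q :- k :* k := con (+ 0)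
            :- con (+ 4) :* q) refl K q)))
        (*-pos (<⇒0< K<r) (+-pos 0<K 0≤r))))

      -- k² − 4d(d−1) − 1 = (s − d)(s + 3d) + (d − 1) + 3d, where k = s + d.
      1≤r : 1# ≤ r
      1≤r r<1 = (0≤⇒≤ (≤-resp refl (begin
          (nat s - D) * (nat s + nat 3 * D) + ((D - 1#) + nat 3 * D)
            ≈⟨ solve 2 (λ s d → (s :- d) :* (s :+ con (+ 3) :* d)
                :+ ((d :- con (+ 1)) :+ con (+ 3) :* d)
                 := (s :+ d) :* (s :+ d) :- con (+ 4) :* (d :* (d :- con (+ 1))) :- con (+ 1))
                     refl (nat s) D ⟩
          (nat s + D) * (nat s + D) - nat 4 * q - 1#
            ≈⟨ +-congʳ (+-congʳ (*-cong (sym K≈s+D) (sym K≈s+D))) ⟩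
          K * K - nat 4 * q - 1#
            ≈⟨ +-congʳ (sym r²) ⟩
          r * r - 1# ∎)
        (+-nonneg (*-nonneg (≤⇒0≤ (nat-mono-≤ d≤s)) (+-nonneg (nat-nonneg s) 0≤3D))
            (+-nonneg (<⇒≤ 0<D-1) 0≤3D))))
        (0<⇒< (<-resp refl (solve 1 (λ r → (con (+ 1) :- r) :* (con (+ 1) :+ r) := con (+ 1)
            :- r :* r) refl r)
          (*-pos (<⇒0< r<1) (+-pos 0<1 0≤r))))
        where 0≤3D = *-nonneg (nat-nonneg 3) (nat-nonneg d)

      0≤μ : 0# ≤ μ
      0≤μ = *-cancelˡ-≤ 0<2 (≤-resp (sym (zeroʳ (nat 2))) (sym 2μ) (≤⇒0≤ r≤K))

    0<L : 0# < L
    0<L = <-resp refl (begin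
      recip 2 * (K + r)     ≈⟨ *-congˡ (sym 2L) ⟩
      recip 2 * (nat 2 * L) ≈⟨ solve 3 (λ i n l → i :* (n :* l) := n :* i :* l) refl
          (recip 2) (nat 2) L ⟩
      nat 2 * recip 2 * L   ≈⟨ *-congʳ (recip-inverse 2) ⟩
      1# * L                ≈⟨ *-identityˡ L ⟩
      L ∎) (*-pos (recip-pos 2) (+-pos 0<K 0≤r))

    private
      x : ℕ → Carrier
      x n = nat (count n)

      x-suc : ∀ n → x (2 ℕ.+ n) ≈ K * x (suc n) - q * x n
      x-suc n = begin
        x (2 ℕ.+ n)
          ≈⟨ solve 2 (λ y c → y := y :+ c :- c) refl (x (2 ℕ.+ n)) (D * D * x n) ⟩
        x (2 ℕ.+ n) + D * D * x n - D * D * x n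
          ≈⟨ +-congʳ (trans (+-congˡ (trans (*-congʳ (sym (nat-* d d)))
              (sym (nat-* (d ℕ.* d) (count n)))))
                  (sym (nat-+ (count (2 ℕ.+ n)) (d ℕ.* d ℕ.* count n)))) ⟩
        nat (count (2 ℕ.+ n) ℕ.+ d ℕ.* d ℕ.* count n) - D * D * x n
          ≈⟨ +-congʳ (reflexive (≡.cong nat (count-recurrence n))) ⟩
        nat (k ℕ.* count (suc n) ℕ.+ d ℕ.* count n) - D * D * x n
          ≈⟨ +-congʳ (trans (nat-+ (k ℕ.* count (suc n)) (d ℕ.* count n))
              (+-cong (nat-* k (count (suc n))) (nat-* d (count n)))) ⟩
        K * x (suc n) + D * x n - D * D * x n
          ≈⟨ solve 3 (λ k d x → k :+ d :* x :- d :* d :* x := k :- (d :* (d :- con (+ 1))) :* x)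
              refl (K * x (suc n)) D (x n) ⟩
        K * x (suc n) - q * x n ∎

      x-one : x 1 ≈ K
      x-one = reflexive (≡.cong nat count-one)

      -- The recurrence x (n+2) = (L + μ) x (n+1) − L μ x n, factored both ways.
      x-suc-μ : ∀ n → x (2 ℕ.+ n) - L * x (suc n) ≈ μ * (x (suc n) - L * x n)
      x-suc-μ n = trans (+-congʳ (trans (x-suc n) (+-congˡ (-‿cong (*-congʳ (sym L*μ))))))
        (solve 4 (λ k l y z → k :* y :- (l :* (k :- l)) :* z :- l :* y :=
            (k :- l) :* (y :- l :* z)) refl K L (x (suc n)) (x n))

      x-suc-L : ∀ n → x (2 ℕ.+ n) - μ * x (suc n) ≈ L * (x (suc n) - μ * x n)
      x-suc-L n = trans (+-congʳ (trans (x-suc n) (+-congˡ (-‿cong (*-congʳ (sym L*μ))))))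
        (solve 4 (λ k l y z → k :* y :- (l :* (k :- l)) :* z :- (k :- l) :* y :=
            l :* (y :- (k :- l) :* z)) refl K L (x (suc n)) (x n))

      -- This difference is geometric with ratio μ ≥ 0 and starts at K - L = μ.
      L-ratio : ∀ n → 0# ≤ x (suc n) - L * x n
      L-ratio zero = ≤-resp refl (+-cong (sym x-one)
          (-‿cong (trans (sym (*-identityˡ L)) (*-comm 1# L)))) 0≤μ
      L-ratio (suc n) = ≤-resp refl (sym (x-suc-μ n)) (*-nonneg 0≤μ (L-ratio n))

    count-lower : ∀ n → pow L n ≤ nat (count n)
    count-lower zero = ≤-refl
    count-lower (suc n) = ≤-trans (*-monoʳ-≤ (<⇒≤ 0<L) (count-lower n)) (0≤⇒≤ (L-ratio n))

    private
      -- Geometric with ratio L, starting at K - μ = L. The count thus obeys an exact first-order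
      -- recurrence, used for the upper bound.
      μ-gap : ∀ n → x (suc n) - μ * x n ≈ L * pow L n
      μ-gap zero = trans (+-congʳ x-one) (solve 2 (λ k l → k :- (k :- l) :* con (+ 1) :=
          l :* con (+ 1)) refl K L)
      μ-gap (suc n) = trans (x-suc-L n) (*-congˡ (μ-gap n))

      0≤pow : ∀ n → 0# ≤ pow L n
      0≤pow zero = <⇒≤ 0<1
      0≤pow (suc n) = *-nonneg (<⇒≤ 0<L) (0≤pow n)

      -- Makes K an admissible constant: if x n ≤ K Lⁿ then x (n + 1) = Lⁿ⁺¹ + μ x n ≤ (L + Kμ) Lⁿ.
      -- Twice the difference of the sides is K(r - 1) + r(K - 1), where 1 ≤ r enters.
      L+Kμ≤KL : L + K * μ ≤ K * L
      L+Kμ≤KL = *-cancelˡ-≤ 0<2 (0≤⇒≤ (≤-resp refl (begin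
        K * (r - 1#) + r * (K - 1#)
          ≈⟨ solve 2 (λ k r → k :* (r :- con (+ 1)) :+ r :* (k :- con (+ 1)) := k :* (k :+ r)
              :- ((k :+ r) :+ k :* (k :- r))) refl K r ⟩
        K * (K + r) - ((K + r) + K * (K - r))
          ≈⟨ +-cong (*-congˡ (sym 2L)) (-‿cong (+-cong (sym 2L) (*-congˡ (sym 2μ)))) ⟩
        K * (nat 2 * L) - (nat 2 * L + K * (nat 2 * μ))
          ≈⟨ solve 3 (λ k l m → k :* (con (+ 2) :* l)
              :- (con (+ 2) :* l :+ k :* (con (+ 2) :* m)) := con (+ 2) :* (k :* l)
                  :- con (+ 2) :* (l :+ k :* m)) refl K L μ ⟩
        nat 2 * (K * L) - nat 2 * (L + K * μ) ∎)
        (+-nonneg (*-nonneg (<⇒≤ 0<K) (≤⇒0≤ 1≤r)) (*-nonneg 0≤r (≤⇒0≤ 1≤K)))))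

    count-upper : ∀ n → nat (count n) ≤ K * pow L n
    count-upper zero = ≤-resp refl (trans (sym (*-identityˡ K)) (*-comm 1# K)) 1≤K
    count-upper (suc n) = ≤-trans
      (≤-resp (trans (+-congʳ (sym (μ-gap n))) (solve 2 (λ x y → x :- y :+ y := x) refl
          (x (suc n)) (μ * x n)))
        (solve 4 (λ l p m k → l :* p :+ m :* (k :* p) := (l :+ k :* m) :* p) refl L (pow L n) μ K)
        (+-mono-≤ ≤-refl (*-monoʳ-≤ 0≤μ (count-upper n))))
      (≤-resp refl (*-assoc K L (pow L n)) (*-monoˡ-≤ (0≤pow n) L+Kμ≤KL))

  module Entropy
    (term : Carrier → ℕ → Carrier)
    (term-zero : ∀ x → term x 0 ≈ 1#)
    (term-suc : ∀ x j → nat (suc j) * term x (suc j) ≈ x * term x j) where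

    open Exponential term term-zero term-suc using (growth-rate)

    _≈ln_ : Carrier → Carrier → Set
    x ≈ln y = (λ n → S n (term x)) ⟶ y

    entropy : ∀ {s d k} → s ℕ.+ d ≡ k → 2 ℕ.≤ d → d ℕ.≤ s →
      (b : (n : ℕ) → .{{NonZero n}} → ℕ) →
      (∀ n .{{_ : NonZero n}} → G.HasVertexCount (G.P n k s) (b n)) →
      (lnb : (n : ℕ) → .{{NonZero n}} → Carrier) →
      (∀ n .{{_ : NonZero n}} → lnb n ≈ln nat (b n)) →
      (r L lnL : Carrier) → 0# ≤ r →
      r * r ≈ nat k * (nat k * 1#) - nat 4 * (nat k - nat s) * (nat k - nat s - 1#) →
      L * (nat k - r) ≈ nat 2 * (nat k - nat s) * (nat k - nat s - 1#) →
      lnL ≈ln L →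
      (λ n → recip n * lnb n) ⟶ lnL
    entropy {s} {d} ≡.refl 2≤d d≤s b vertices lnb lnb-spec r L lnL 0≤r r*r L-eq lnL-spec =
      growth-rate {L} {lnL} {nat (s ℕ.+ d)} 0<L (⟶⇒Lim lnL-spec) (λ n → nat (b n)) lnb
          (λ n → ⟶⇒Lim (lnb-spec n))
        (λ { n@(suc _) → ≤-resp refl (b≈count n) (count-lower n) })
        (λ { n@(suc _) → ≤-resp (b≈count n) refl (count-upper n) })
      where
      open Asymptotics s d 2≤d d≤s r L 0≤r r*r L-eq
      open Words s d d≤s using (count)
      instance
        k≢0 : NonZero (s ℕ.+ d)
        k≢0 = ℕ.>-nonZero (ℕ.<-≤-trans (ℕ.<-≤-trans (s≤s z≤n) 2≤d) (ℕ.m≤n+m d s))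
      b≈count : ∀ n .{{_ : NonZero n}} → nat (count n) ≈ nat (b n)
      b≈count (suc n) = reflexive (≡.cong nat
          (≡.sym (G.vertexCount s d d≤s n (b (suc n)) (vertices (suc n)))))

-- Transfer to the Cauchy reals.

open import Defs

private
  term : ℝ → ℕ → ℝ
  term x j = x ^ j * 1/ j !

  open Growth.Entropy ℝ-field term (λ x → Ordered.*-identityˡ ℝ-field 1ℝ)
      (λ x j → Growth.power-term-suc ℝ-field x (x ^ j) j) using (entropy)

corollary4p19 : (k s : ℕ) .{{_ : NonZero k}} .{{_ : NonZero s}} →
    ⌈ k /2⌉ ℕ.≤ s → s ℕ.+ 2 ℕ.≤ k →
    (b : (n : ℕ) → .{{NonZero n}} → ℕ) →
    (∀ n .{{_ : NonZero n}} → HasVertexCount (P n k s) (b n)) →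
    (lnb : (n : ℕ) → .{{NonZero n}} → ℝ) →
    (∀ n .{{_ : NonZero n}} → lnb n ≈ln fromℕ (b n)) →
    (r L lnL : ℝ) →
    r ≈√ (fromℕ k ^ 2 - fromℕ 4 * (fromℕ k - fromℕ s) * (fromℕ k - fromℕ s - 1ℝ)) →
    L ≈ fromℕ 2 * (fromℕ k - fromℕ s) * (fromℕ k - fromℕ s - 1ℝ) ÷ (fromℕ k - r) →
    lnL ≈ln L →
    (λ n → 1/ℕ n * lnb n) ⟶ lnL
corollary4p19 k s k/2≤s s+2≤k b vertices lnb lnb-spec r L lnL (0≤r , r*r) (_ , L-eq) lnL-spec
  -- With d = k - s, the bounds on s become 2 ≤ d, which makes d(d - 1) positive, and d ≤ s, which
  -- keeps non-consecutive blocks disjoint.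
  = entropy s+d≡k (ℕ.+-cancelˡ-≤ s 2 (k ℕ.∸ s) (≡.subst (s ℕ.+ 2 ℕ.≤_) (≡.sym s+d≡k) s+2≤k))
    (ℕ.+-cancelˡ-≤ s (k ℕ.∸ s) s (≡.subst (ℕ._≤ s ℕ.+ s) (≡.sym s+d≡k) k≤s+s))
    b vertices lnb lnb-spec r L lnL 0≤r r*r L-eq lnL-spec
  where
  s+d≡k : s ℕ.+ (k ℕ.∸ s) ≡ k
  s+d≡k = ℕ.m+[n∸m]≡n (ℕ.m+n≤o⇒m≤o s s+2≤k)
  k≤s+s : k ℕ.≤ s ℕ.+ s
  k≤s+s = ℕ.≤-trans (ℕ.≤-reflexive (≡.sym (ℕ.⌊n/2⌋+⌈n/2⌉≡n k)))
    (ℕ.+-mono-≤ (ℕ.≤-trans (ℕ.⌊n/2⌋≤⌈n/2⌉ k) k/2≤s) k/2≤s)
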